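{- Let $\Delta\ge 1$ and $k\ge 0$ be fixed integers. Suppose there is a polynomial size gadget, i.e. a realizable instance $(\hat G,\hat D,\Delta)$ of $\Delta$-$k$-DiTTR (of size polynomial in $\Delta$ and $k$), which enforces $\lambda(v_1,v_2)=\lambda(v_2,v_1)$ for some specific pair of adjacent vertices $(v_1,v_2)$ of $\hat G$. Then $\Delta$-$k$-TTR can be reduced in polynomial time to $\Delta$-$k$-DiTTR.
   Context: All graphs are finite. A $\Delta$-periodic labeling of an undirected or directed graph $G=(V,E)$ is a map $\lambda:E\to\{0,1,\dots,\Delta-1\}$; edge $e$ is then active exactly at the times $\lambda(e)+i\Delta$, $i\in\mathbb{N}_0$ (an undirected edge is active in both directions). A temporal $s$-$z$-path is a sequence $(v_{i-1},v_i,t_i)_{i=1}^{\ell}$ with $v_0=s$, $v_\ell=z$, pairwise distinct vertices $v_0,\dots,v_\ell$, the edge from $v_{i-1}$ to $v_i$ in $E$ and active at time $t_i$ for every $i$, and $t_1<t_2<\dots<t_\ell$ (strictly increasing). Its duration is $t_\ell+1-t_1$. A fastest temporal path is one of minimum duration. $\hat d(u,v)$ is the distance from $u$ to $v$ in the static graph $G$ (all edges have unit length). A bidirected tree is the directed graph obtained from an undirected tree by replacing each edge $\{u,v\}$ by the two directed edges $(u,v),(v,u)$ (which may get different labels). For fixed $\Delta,k$, an instance of $\Delta$-$k$-TTR (resp. $\Delta$-$k$-DiTTR) consists of an undirected tree (resp. bidirected tree) $G=(V,E)$ and a matrix $D$ indexed by $V\times V$ with entries positive integers or $\infty$ (no restriction)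 such that $D_{u,v}\ge\hat d(u,v)+k$ for all $u,v$. The question is whether the instance is realizable, i.e. whether there is a $\Delta$-periodic labeling $\lambda$ of $E$ (a valid labeling) such that, for all $u,v\in V$, the duration of a fastest temporal path from $u$ to $v$ is at most $D_{u,v}$. Diagonal entries of $D$ play no role; all conditions on $D$ are for distinct vertices. An instance enforces $\lambda(v_1,v_2)=\lambda(v_2,v_1)$ if this equality holds for every valid labeling $\lambda$ of the instance. -}

module Defs where

open import Data.Bool.Base using (Bool; true; false; T; if_then_else_)
open import Data.Digit using (toDigits)
open import Data.Fin.Base using (Fin; zero; suc; toℕ)
open import Data.List.Base as List using (List; []; _∷_; _++_; [_]; concat; tabulate; drop; head)
open import Data.List.Relation.Unary.Linked using (Linked)
open import Data.List.Relation.Unary.Unique.Propositional using (Unique)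
open import Data.Maybe.Base using (Maybe)
open import Data.Nat.Base using (ℕ; suc; _+_; _*_; _∸_; _^_; _≤_; _<_)
open import Data.Product.Base using (Σ-syntax; ∃-syntax; _×_; proj₁)
open import Data.Vec.Base as Vec using (Vec; lookup; _[_]≔_; replicate)
open import Function.Bundles using (_⇔_)
open import Relation.Binary.PropositionalEquality.Core using (_≡_; _≢_)
open import Relation.Nullary.Construct.Add.Supremum using (_⁺; ⊤⁺) renaming ([_] to fin)
open import Relation.Nullary.Negation.Core using (¬_)
import Relation.Binary.Construct.Add.Supremum.NonStrict as AddSupremum

open AddSupremum _≤_ public using (_≤⁺_)

------------------------------------------------------------------------
-- Graphs and trees

record Graph (n : ℕ) : Set where
  field
    adj         : Fin n → Fin n → Bool

  Adj : Fin n → Fin n → Set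
  Adj u v = T (adj u v)

  field
    symmetric   : ∀ {u v} → Adj u v → Adj v u
    irreflexive : ∀ {u} → ¬ Adj u u

module _ {n : ℕ} (G : Graph n) where
  open Graph G

  data Walk : Fin n → Fin n → Set where
    []  : ∀ {u} → Walk u u
    _∷_ : ∀ {u v w} → Adj u v → Walk v w → Walk u w

module _ {n : ℕ} {G : Graph n} where

  edges : ∀ {u v} → Walk G u v → ℕ
  edges []      = 0
  edges (_ ∷ w) = suc (edges w)

  vertices : ∀ {u v} → Walk G u v → List (Fin n)
  vertices {u} []      = u ∷ []
  vertices {u} (_ ∷ w) = u ∷ vertices w

module _ {n : ℕ} (G : Graph n) where
  open Graph G

  record Path (u v : Fin n) : Set where
    field
      walk     : Walk G u v
      distinct : Unique (vertices walk)

  -- A cycle is a path on at least three vertices whose ends are adjacent.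
  record IsTree : Set where
    field
      nonempty  : 1 ≤ n
      connected : ∀ u v → Path u v
      acyclic   : ∀ {u v} (P : Path u v) → 2 ≤ edges (Path.walk P) → ¬ Adj v u

  -- IsDistance u v d:  the distance from u to v in G is d.
  IsDistance : Fin n → Fin n → ℕ → Set
  IsDistance u v d =
    (∃[ P ] edges (Path.walk {u} {v} P) ≡ d) ×
    ((P : Path u v) → d ≤ edges (Path.walk P))

------------------------------------------------------------------------
-- Periodic labelings and temporal paths

-- A labeling of the bidirected version of G: the two directions of an
-- edge are labeled independently.
DiLabeling : ℕ → ∀ {n} → Graph n → Set
DiLabeling Δ {n} G = (u v : Fin n) → .(Graph.Adj G u v) → Fin Δ

-- A labeling of the undirected edges of G: a function of oriented edges
-- that does not depend on the orientation.
record Labeling (Δ : ℕ) {n : ℕ} (G : Graph n) : Set where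
  open Graph G
  field
    label      : DiLabeling Δ G
    unoriented : ∀ u v (e : Adj u v) → label u v e ≡ label v u (symmetric e)

duration : List ℕ → ℕ
duration []       = 0   -- arises only for a path from a vertex to itself
duration (t ∷ ts) = final t ts + 1 ∸ t
  where
  final : ℕ → List ℕ → ℕ
  final t []       = t
  final _ (t ∷ ts) = final t ts

module _ {Δ n : ℕ} (G : Graph n) (lab : DiLabeling Δ G) where
  open Graph G

  ActiveAt : (u v : Fin n) → Adj u v → ℕ → Set
  ActiveAt u v e t = ∃[ i ] t ≡ toℕ (lab u v e) + i * Δ

  -- The i-th edge of the walk is active at the i-th time in the list.
  data Active : ∀ {u v} → Walk G u v → List ℕ → Set where
    []  : ∀ {u} → Active ([] {u = u}) []
    _∷_ : ∀ {u v w} {e : Adj u v} {W : Walk G v w} {t ts} →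
          ActiveAt u v e t → Active W ts → Active (e ∷ W) (t ∷ ts)

  record TemporalPath (u v : Fin n) : Set where
    field
      path       : Path G u v
      times      : List ℕ
      active     : Active (Path.walk path) times
      increasing : Linked _<_ times

  open TemporalPath

  IsFastest : ∀ {u v} → TemporalPath u v → Set
  IsFastest {u} {v} P = (Q : TemporalPath u v) → duration (times P) ≤ duration (times Q)

  -- The duration of a fastest temporal path is at most D u v whenever u ≢ v.
  Respects : (Fin n → Fin n → ℕ ⁺) → Set
  Respects D = ∀ u v → u ≢ v →
    Σ[ P ∈ TemporalPath u v ] IsFastest P × fin (duration (times P)) ≤⁺ D u v

------------------------------------------------------------------------
-- Instances

-- The bidirected tree of a tree has the same adjacency matrix and the
-- same distances as the tree, so the directed and the undirected
-- problem share their instances and differ in the labelings.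
record Instance (k : ℕ) : Set where
  field
    n        : ℕ
    G        : Graph n
    isTree   : IsTree G
    D        : Fin n → Fin n → ℕ ⁺
    positive : ∀ u v → fin 1 ≤⁺ D u v
    bound    : ∀ u v → u ≢ v → ∀ d → IsDistance G u v d → fin (d + k) ≤⁺ D u v

module _ (Δ : ℕ) {k : ℕ} (I : Instance k) where
  open Instance I

  Realizable : Set
  Realizable = Σ[ l ∈ Labeling Δ G ] Respects G (Labeling.label l) D

  DiRealizable : Set
  DiRealizable = Σ[ l ∈ DiLabeling Δ G ] Respects G l D

  EnforcesEqual : (v₁ v₂ : Fin n) → Graph.Adj G v₁ v₂ → Set
  EnforcesEqual v₁ v₂ e =
    (l : DiLabeling Δ G) → Respects G l D → l v₁ v₂ e ≡ l v₂ v₁ (Graph.symmetric G e)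

------------------------------------------------------------------------
-- Words encoding instances

data Symbol : Set where
  𝟘 𝟙 ∞ comma semicolon bar : Symbol

Word : Set
Word = List Symbol

bit : Bool → Word
bit b = [ (if b then 𝟙 else 𝟘) ]

-- Binary notation, least significant digit first.
binary : ℕ → Word
binary m = List.map digit (proj₁ (toDigits 2 m))
  where
  digit : Fin 2 → Symbol
  digit zero    = 𝟘
  digit (suc _) = 𝟙

entry : ℕ ⁺ → Word
entry (fin m) = binary m
entry ⊤⁺      = [ ∞ ]

-- Row by row; entries end in a comma, rows in a semicolon, the matrix in a bar.
matrix : ∀ {n} {A : Set} → (A → Word) → (Fin n → Fin n → A) → Word
matrix enc M =
  concat (tabulate λ u → concat (tabulate λ v → enc (M u v) ++ [ comma ]) ++ [ semicolon ])
  ++ [ bar ]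

encode : ∀ {k} → Instance k → Word
encode I = matrix bit (Graph.adj G) ++ matrix entry D
  where open Instance I

size : ∀ {k} → Instance k → ℕ
size I = List.length (encode I)

------------------------------------------------------------------------
-- Polynomial time

-- Structured programs for a machine with s stacks of symbols.  Every
-- elementary step inspects or changes the top of one stack.  A stack is
-- part of a Turing machine tape and a tape is two stacks, so running
-- times agree with those of multitape Turing machines up to a constant
-- factor.
data Program (s : ℕ) : Set where
  skip   : Program s
  push   : Fin s → Symbol → Program s
  pop    : Fin s → Program s
  _⨟_    : Program s → Program s → Program s
  switch : Fin s → (Maybe Symbol → Program s) → Program s
  while  : Fin s → (Maybe Symbol → Bool) → Program s → Program s

infixr 5 _⨟_

Store : ℕ → Set
Store s = Vec Word s

top : ∀ {s} → Fin s → Store s → Maybe Symbol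
top i σ = head (lookup σ i)

-- p ⊢ σ ⇓[ t ] τ :  p started in σ halts in τ after t steps.
infix 4 _⊢_⇓[_]_

data _⊢_⇓[_]_ {s : ℕ} : Program s → Store s → ℕ → Store s → Set where
  skip   : ∀ {σ} → skip ⊢ σ ⇓[ 1 ] σ
  push   : ∀ {σ i a} → push i a ⊢ σ ⇓[ 1 ] σ [ i ]≔ (a ∷ lookup σ i)
  pop    : ∀ {σ i} → pop i ⊢ σ ⇓[ 1 ] σ [ i ]≔ drop 1 (lookup σ i)
  seq    : ∀ {p q σ τ ρ t t′} →
           p ⊢ σ ⇓[ t ] τ → q ⊢ τ ⇓[ t′ ] ρ → p ⨟ q ⊢ σ ⇓[ t + t′ ] ρ
  switch : ∀ {i f σ τ t} →
           f (top i σ) ⊢ σ ⇓[ t ] τ → switch i f ⊢ σ ⇓[ suc t ] τ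
  stop   : ∀ {i c p σ} →
           c (top i σ) ≡ false → while i c p ⊢ σ ⇓[ 1 ] σ
  loop   : ∀ {i c p σ τ ρ t t′} →
           c (top i σ) ≡ true → p ⊢ σ ⇓[ t ] τ → while i c p ⊢ τ ⇓[ t′ ] ρ →
           while i c p ⊢ σ ⇓[ suc (t + t′) ] ρ

-- Stack 0 holds the input at the start, all other stacks being empty,
-- and the output at the end.
Computes : ∀ {s} → Program (suc s) → Word → ℕ → Word → Set
Computes {s} p x t y =
  ∃[ τ ] (p ⊢ x Vec.∷ replicate s [] ⇓[ t ] τ) × Vec.head τ ≡ y

record Problem : Set₁ where
  field
    Input : Set
    word  : Input → Word
    Yes   : Input → Set

open Problem

PolynomialTime : (A B : Problem) → (Input A → Input B) → Set
PolynomialTime A B f =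
  Σ[ s ∈ ℕ ] Σ[ p ∈ Program (suc s) ] Σ[ c ∈ ℕ ] Σ[ d ∈ ℕ ] (∀ x →
    Σ[ t ∈ ℕ ] Computes p (word A x) t (word B (f x)) ×
               t ≤ c * List.length (word A x) ^ d + c)

infix 4 _≤ᵖ_

_≤ᵖ_ : Problem → Problem → Set
A ≤ᵖ B = Σ[ f ∈ (Input A → Input B) ]
  PolynomialTime A B f × (∀ x → Yes A x ⇔ Yes B (f x))

TTR : (Δ k : ℕ) → Problem
TTR Δ k = record { Input = Instance k ; word = encode ; Yes = Realizable Δ }

DiTTR : (Δ k : ℕ) → Problem
DiTTR Δ k = record { Input = Instance k ; word = encode ; Yes = DiRealizable Δ }

------------------------------------------------------------------------
-- Gadgets

record Gadget (Δ k : ℕ) : Set where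
  field
    inst       : Instance k
  open Instance inst public
  field
    realizable : DiRealizable Δ inst
    v₁ v₂      : Fin n
    adjacent   : Graph.Adj G v₁ v₂
    enforces   : EnforcesEqual Δ inst v₁ v₂ adjacent

{-# OPTIONS --safe #-}

-- Hang a copy of the gadget at every ordered pair (u , v) of vertices of the tree, with
-- v₁ at u and v₂ at v, and impose the gadget's bounds on the copy exactly when u and v
-- are adjacent; all other new bounds are ∞.  The result is a tree whether or not u and v
-- are adjacent, so the layout depends on n only.  In trees paths are unique, hence the
-- duration of a fastest temporal path is one plus the sum of the waiting gaps between
-- consecutive labels along a fixed path.  These gaps do not change when all labels of a
-- copy are rotated modulo Δ, so a gadget labeling can be rotated to agree with an
-- undirected labeling on the identified edge; conversely each copy forces the two labels
-- of its edge to be equal.  The gadget being a constant, the new encoding is printed by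
-- a fixed number of nested loops over the vertices.
module Submission where

open import Defs
open import Data.Bool.Base using (Bool; true; false; T; not; if_then_else_; _∧_)
open import Data.Bool.Properties using (T-irrelevant)
open import Data.Fin using (_≟_)
open import Data.Fin.Base using (Fin; zero; suc; toℕ; fromℕ; fromℕ<; inject₁; _↑ʳ_; _↑ˡ_; remQuot; combine)
open import Data.Fin.Properties using (toℕ-fromℕ; toℕ-inject₁; toℕ-injective; toℕ<n; toℕ-fromℕ<; remQuot-combine; combine-remQuot)
open import Data.List.Base as List using (List; []; _∷_; _++_; [_]; concat; tabulate; length; _ʳ++_)
open import Data.List.Membership.DecPropositional using () renaming (_∈?_ to member?)
open import Data.List.Membership.Propositional using (_∈_; _∉_)
open import Data.List.Properties using (++-assoc; ++-identityʳ; length-++; length-ʳ++; ʳ++-ʳ++; tabulate-cong)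
open import Data.List.Relation.Unary.All as All using (All; []; _∷_)
import Data.List.Relation.Unary.All.Properties as Allₚ
open import Data.List.Relation.Unary.AllPairs using ([]; _∷_)
open import Data.List.Relation.Unary.Any using (here; there)
open import Data.List.Relation.Unary.Linked using (Linked; []; [-]; _∷_)
open import Data.List.Relation.Unary.Unique.Propositional using (Unique)
import Data.List.Relation.Unary.Unique.Propositional.Properties as Uniqueₚ
open import Data.Maybe.Base using (Maybe; just; nothing; is-just)
open import Data.Nat.Base
open import Data.Nat.DivMod using (_%_; _/_; m≡m%n+[m/n]*n; m%n<n)
open import Data.Nat.Properties hiding (_≟_)
open import Data.Nat.Tactic.RingSolver using (solve-∀)
open import Data.Product.Base using (Σ-syntax; ∃-syntax; _×_; _,_; proj₁; proj₂; uncurry)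
open import Data.Sum.Base using (_⊎_; inj₁; inj₂; [_,_]′)
open import Data.Unit.Base using (tt)
open import Data.Vec.Base as Vec using (Vec; []; _∷_; lookup; _[_]≔_; replicate)
open import Data.Vec.Properties using (lookup∘update; lookup∘update′; []≔-idempotent; []≔-lookup; lookup-map; map-[]≔; lookup-replicate; map-replicate)
open import Function.Base using (_∘_; id)
open import Function.Bundles using (_⇔_; mk⇔)
open import Relation.Binary.Construct.Add.Supremum.NonStrict _≤_ using (_≤⊤⁺; ≤⁺-trans) renaming ([_] to fin≤)
open import Relation.Binary.PropositionalEquality hiding ([_])
open import Relation.Nullary.Construct.Add.Supremum using (_⁺; ⊤⁺) renaming ([_] to fin)
open import Relation.Nullary.Decidable using (Dec; yes; no; does; map′; T?)
open import Relation.Nullary.Negation using (¬_; contradiction)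

-- Paths and cycles

-- Why gluing never closes a cycle: the edge between `v₁` and `v₂` is not part of a copy; only a
-- tree edge can play its role. Without it the gadget falls into two trees, one hung at `u` and one
-- at `v`. Adjacency of `u` and `v` thus affects the bounds alone, and a program can enumerate the
-- new vertices without numbering the edges. Two points need care. The entry for two tree vertices
-- is already taken by `D`, so the gadget's own entries between `v₁` and `v₂` are dropped; this is
-- harmless because a single edge always has duration 1. And rotating a copy moves the labels of
-- `(v₁ , v₂)` and `(v₂ , v₁)` by the same amount, whereas both directions of the tree edge have
-- prescribed labels; they agree because the gadget enforces the equality on its own labeling and
-- the given labeling is unoriented. Every finite bound lies inside the tree or inside one copy, so
-- the separate rotations do not interfere.

∉-head : ∀ {A : Set} {x : A} {xs} → All (x ≢_) xs → x ∉ xs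
∉-head (x≢y ∷ _)  (here x≡y) = x≢y x≡y
∉-head (_ ∷ x≢ys) (there x∈) = ∉-head x≢ys x∈

∉⇒All≢ : ∀ {A : Set} {x : A} {xs} → x ∉ xs → All (x ≢_) xs
∉⇒All≢ x∉ = All.tabulate λ y∈ x≡y → x∉ (subst (_∈ _) (sym x≡y) y∈)

maximal : ∀ {A : Set} (f : A → ℕ) x xs → ∃[ m ] m ∈ x ∷ xs × (∀ {y} → y ∈ x ∷ xs → f y ≤ f m)
maximal f x []       = x , here refl , λ { (here refl) → ≤-refl }
maximal f x (y ∷ ys) with maximal f y ys
... | m , m∈ , max with ≤-total (f x) (f m)
... | inj₁ x≤m = m , there m∈ , λ { (here refl) → x≤m ; (there z∈) → max z∈ }
... | inj₂ m≤x = x , here refl , λ { (here refl) → ≤-refl ; (there z∈) → ≤-trans (max z∈) m≤x }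

module _ {n : ℕ} {G : Graph n} where
  open Graph G

  start∈ : ∀ {u v} (W : Walk G u v) → u ∈ vertices W
  start∈ []      = here refl
  start∈ (_ ∷ _) = here refl

  end∈ : ∀ {u v} (W : Walk G u v) → v ∈ vertices W
  end∈ []      = here refl
  end∈ (_ ∷ W) = there (end∈ W)

  _⊕_ : ∀ {u v w} → Walk G u v → Walk G v w → Walk G u w
  []      ⊕ W′ = W′
  (e ∷ W) ⊕ W′ = e ∷ (W ⊕ W′)

  ∈-⊕ : ∀ {u v w x} (W : Walk G u v) (W′ : Walk G v w) → x ∈ vertices (W ⊕ W′) → x ∈ vertices W ⊎ x ∈ vertices W′
  ∈-⊕ []      W′ x∈         = inj₂ x∈
  ∈-⊕ (_ ∷ W) W′ (here x≡u) = inj₁ (here x≡u)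
  ∈-⊕ (_ ∷ W) W′ (there x∈) with ∈-⊕ W W′ x∈
  ... | inj₁ x∈W  = inj₁ (there x∈W)
  ... | inj₂ x∈W′ = inj₂ x∈W′

  backward : ∀ {u v} → Walk G u v → Walk G v u
  backward []      = []
  backward (e ∷ W) = backward W ⊕ (symmetric e ∷ [])

  ∈-backward : ∀ {u v x} (W : Walk G u v) → x ∈ vertices (backward W) → x ∈ vertices W
  ∈-backward []      x∈ = x∈
  ∈-backward (e ∷ W) x∈ with ∈-⊕ (backward W) (symmetric e ∷ []) x∈
  ... | inj₁ x∈W                = there (∈-backward W x∈W)
  ... | inj₂ (here refl)         = there (start∈ W)
  ... | inj₂ (there (here refl)) = here refl

  suffix : ∀ {u v x} (W : Walk G u v) → Unique (vertices W) → x ∈ vertices W →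
    Σ[ P ∈ Path G x v ] (∀ {y} → y ∈ vertices (Path.walk P) → y ∈ vertices W) × edges (Path.walk P) ≤ edges W
  suffix []      un       (here refl) = record { walk = [] ; distinct = un } , id , ≤-refl
  suffix (e ∷ W) un       (here refl) = record { walk = e ∷ W ; distinct = un } , id , ≤-refl
  suffix (e ∷ W) (_ ∷ un) (there x∈)  with suffix W un x∈
  ... | P , P⊆W , P≤W = P , there ∘ P⊆W , m≤n⇒m≤1+n P≤W

  -- Loop erasure. The vertices are tracked so that whatever the walk avoids is still avoided by the
  -- path.
  erase : ∀ {u v} (W : Walk G u v) → Σ[ P ∈ Path G u v ] (∀ {y} → y ∈ vertices (Path.walk P) → y ∈ vertices W)
  erase [] = record { walk = [] ; distinct = [] ∷ [] } , id
  erase {u} (e ∷ W) with erase W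
  ... | P , P⊆W with member? _≟_ u (vertices (Path.walk P))
  ... | no  u∉P = record { walk = e ∷ Path.walk P ; distinct = ∉⇒All≢ u∉P ∷ Path.distinct P } ,
                  λ { (here refl) → here refl ; (there y∈) → there (P⊆W y∈) }
  ... | yes u∈P with suffix (Path.walk P) (Path.distinct P) u∈P
  ... | Q , Q⊆P , _ = Q , there ∘ P⊆W ∘ Q⊆P

  edge-path : ∀ {u v} → Adj u v → Path G u v
  edge-path {u} e = record
    { walk     = e ∷ []
    ; distinct = ((λ u≡v → irreflexive (subst (Adj u) (sym u≡v) e)) ∷ []) ∷ ([] ∷ []) }

  nonloop : ∀ {u v} → Adj u v → u ≢ v
  nonloop {u} e u≡v = irreflexive (subst (Adj u) (sym u≡v) e)

  module _ (tree : IsTree G) where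
    open IsTree tree

    -- Where two paths to a common end part, at neighbours `a` and `b` of the current vertex, going
    -- along one and back along the other leads from `a` to `b` without meeting that vertex. Erasing
    -- loops and prepending the edge to `a` yields a path that the edge to `b` closes to a cycle.
    same-walk : ∀ {u v} (W W′ : Walk G u v) → Unique (vertices W) → Unique (vertices W′) → W ≡ W′
    same-walk []      []        _          _            = refl
    same-walk []      (_ ∷ W′)  _          (u∉ ∷ _)     = contradiction (end∈ W′) (∉-head u∉)
    same-walk (_ ∷ W) []        (u∉ ∷ _)   _            = contradiction (end∈ W) (∉-head u∉)
    same-walk (_∷_ {v = a} e W) (_∷_ {v = b} e′ W′) (u∉ ∷ un) (u∉′ ∷ un′) with a ≟ b
    ... | yes refl = cong₂ _∷_ (T-irrelevant e e′) (same-walk W W′ un un′)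
    ... | no  a≢b with erase (W ⊕ backward W′)
    ... | record { walk = [] } , _ = contradiction refl a≢b
    ... | P@(record { walk = f ∷ R ; distinct = d }) , P⊆ = contradiction (symmetric e′)
      (acyclic (record { walk = e ∷ f ∷ R ; distinct = ∉⇒All≢ outside ∷ d }) (s≤s (s≤s z≤n)))
      where
      outside : _ ∉ vertices (f ∷ R)
      outside x∈ with ∈-⊕ W (backward W′) (P⊆ x∈)
      ... | inj₁ x∈W  = ∉-head u∉ x∈W
      ... | inj₂ x∈W′ = ∉-head u∉′ (∈-backward W′ x∈W′)

    same-path : ∀ {u v} (P Q : Path G u v) → Path.walk P ≡ Path.walk Q
    same-path P Q = same-walk (Path.walk P) (Path.walk Q) (Path.distinct P) (Path.distinct Q)

    path-distance : ∀ {u v} (P : Path G u v) → IsDistance G u v (edges (Path.walk P))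
    path-distance P = (P , refl) , λ Q → ≤-reflexive (cong edges (same-path P Q))

    depth : Fin n → Fin n → ℕ
    depth r x = edges (Path.walk (connected x r))

    depth-edge : ∀ {r x} → Adj x r → depth r x ≡ 1
    depth-edge e = cong edges (same-path (connected _ _) (edge-path e))

    depth-root : ∀ r → depth r r ≡ 0
    depth-root r = cong edges (same-path (connected r r) (record { walk = [] ; distinct = [] ∷ [] }))

    depth>0 : ∀ {r x} → x ≢ r → 0 < depth r x
    depth>0 {r} {x} x≢r with Path.walk (connected x r)
    ... | []    = contradiction refl x≢r
    ... | _ ∷ _ = s≤s z≤n

    proper-suffix : ∀ {x y r} → Adj x y → (W : Walk G y r) → Unique (vertices W) → x ∈ vertices W →
      Σ[ P ∈ Path G x r ] edges (Path.walk P) < edges W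
    proper-suffix e []      _        (here refl) = contradiction refl (nonloop e)
    proper-suffix e (_ ∷ _) _        (here refl) = contradiction refl (nonloop e)
    proper-suffix e (_ ∷ W) (_ ∷ un) (there x∈) with suffix W un x∈
    ... | P , _ , P≤W = P , s≤s P≤W

    -- If `x` lay on the path from `y` to the root, the rest of that path would make `x` strictly
    -- less deep than `y`. So the edge can be prepended, and uniqueness of paths does the rest.
    ascend : ∀ {r x y} (e : Adj x y) → depth r y ≤ depth r x →
      Path.walk (connected x r) ≡ e ∷ Path.walk (connected y r)
    ascend {r} {x} {y} e y≤x = same-walk _ _ (Path.distinct (connected x r)) (∉⇒All≢ x∉ ∷ Path.distinct (connected y r))
      where
      x∉ : x ∉ vertices (Path.walk (connected y r))
      x∉ x∈ with proper-suffix e (Path.walk (connected y r)) (Path.distinct (connected y r)) x∈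
      ... | P , P<y = <-irrefl refl (≤-trans (≤-trans (s≤s (≤-reflexive (cong edges (same-path (connected x r) P)))) P<y) y≤x)

    -- Both neighbours come second on the one path from `x` to the root: the parent is the only
    -- neighbour that is no deeper.
    ascend-unique : ∀ {r x y z} → Adj x y → Adj x z → depth r y ≤ depth r x → depth r z ≤ depth r x → y ≡ z
    ascend-unique e f y≤x z≤x = second (trans (sym (ascend e y≤x)) (ascend f z≤x))
      where
      second : ∀ {r x y z} {e : Adj x y} {f : Adj x z} {W : Walk G y r} {W′ : Walk G z r} →
        _≡_ {A = Walk G x r} (e ∷ W) (f ∷ W′) → y ≡ z
      second refl = refl

  TwoNeighbours : Fin n → List (Fin n) → Set
  TwoNeighbours x xs = ∃[ y ] ∃[ z ] y ∈ xs × z ∈ xs × Adj x y × Adj x z × y ≢ z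

  penultimate : ∀ {u v} (W : Walk G u v) → Unique (vertices W) → 2 ≤ edges W →
    ∃[ p ] p ∈ vertices W × Adj v p × u ≢ p
  penultimate (e ∷ [])           _        (s≤s ())
  penultimate (e ∷ f ∷ [])       _        _ = _ , there (here refl) , symmetric f , nonloop e
  penultimate (e ∷ W@(_ ∷ _ ∷ _)) (u∉ ∷ un) _ with penultimate W un (s≤s (s≤s z≤n))
  ... | p , p∈ , a , _ = p , there p∈ , a , λ { refl → ∉-head u∉ p∈ }

  inner-neighbours : ∀ {u v x} (W : Walk G u v) → Unique (vertices W) → x ∈ vertices W →
    x ≡ u ⊎ x ≡ v ⊎ TwoNeighbours x (vertices W)
  inner-neighbours []      _ (here x≡u) = inj₁ x≡u
  inner-neighbours (_ ∷ _) _ (here x≡u) = inj₁ x≡u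
  inner-neighbours (e ∷ W) (u∉ ∷ un) (there x∈) with inner-neighbours W un x∈
  ... | inj₂ (inj₁ x≡v) = inj₂ (inj₁ x≡v)
  ... | inj₂ (inj₂ (y , z , y∈ , z∈ , rest)) = inj₂ (inj₂ (y , z , there y∈ , there z∈ , rest))
  inner-neighbours (e ∷ [])        _         (there x∈) | inj₁ refl = inj₂ (inj₁ refl)
  inner-neighbours (e ∷ W@(f ∷ W′)) (u∉ ∷ un) (there x∈) | inj₁ refl =
    inj₂ (inj₂ (_ , _ , here refl , there (there (start∈ W′)) , symmetric e , f ,
                λ { refl → ∉-head u∉ (there (start∈ W′)) }))

  -- An inner vertex has its predecessor and successor on the path. At either end the closing edge
  -- supplies the missing second neighbour.
  cycle-neighbours : ∀ {u v x} (W : Walk G u v) → Unique (vertices W) → 2 ≤ edges W → Adj v u →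
    x ∈ vertices W → TwoNeighbours x (vertices W)
  cycle-neighbours W un 2≤ a x∈ with inner-neighbours W un x∈
  ... | inj₂ (inj₂ two) = two
  ... | inj₂ (inj₁ refl) with penultimate W un 2≤
  ... | p , p∈ , b , u≢p = _ , p , start∈ W , p∈ , a , b , u≢p
  cycle-neighbours (e ∷ [])        _  (s≤s ()) a x∈ | inj₁ refl
  cycle-neighbours (e ∷ W@(_ ∷ W′)) (_ ∷ (b∉ ∷ _)) 2≤ a x∈ | inj₁ refl =
    _ , _ , there (here refl) , there (end∈ W) , e , symmetric a , λ { refl → ∉-head b∉ (end∈ W′) }

module _ {n n′ : ℕ} {H : Graph n} {G : Graph n′} (ι : Fin n → Fin n′)
  (reflects : ∀ {a b} → Graph.Adj G (ι a) (ι b) → Graph.Adj H a b)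
  (rank : Fin n′ → ℕ) (lowest : ∀ x → rank x ≡ 0 → ∃[ a ] x ≡ ι a)
  where
  open Graph G

  pull-walk : ∀ {x y} (W : Walk G x y) → All (λ z → rank z ≡ 0) (vertices W) → ∀ {a} → x ≡ ι a →
    ∃[ b ] y ≡ ι b × (Σ[ W′ ∈ Walk H a b ] List.map ι (vertices W′) ≡ vertices W × edges W′ ≡ edges W)
  pull-walk []      (_ ∷ []) x≡ = _ , x≡ , [] , cong [_] (sym x≡) , refl
  pull-walk (_∷_ {v = y} e W) (_ ∷ zs) refl
    with lowest y (All.lookup zs (start∈ W))
  ... | a′ , refl with pull-walk W zs refl
  ... | b , y≡ , W′ , vs , es = b , y≡ , reflects e ∷ W′ , cong (_ ∷_) vs , cong suc es

  -- On a cycle, a vertex of greatest rank has two neighbours of no greater rank.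
  extension-acyclic : IsTree H →
    (∀ {x y z} → 0 < rank x → Adj x y → Adj x z → rank y ≤ rank x → rank z ≤ rank x → y ≡ z) →
    ∀ {u v} (P : Path G u v) → 2 ≤ edges (Path.walk P) → ¬ Adj v u
  extension-acyclic tree lonely {u} P 2≤ e with Path.walk P | Path.distinct P
  ... | W@(f ∷ W₀) | un with maximal rank u (vertices W₀)
  ... | m , m∈ , max with rank m in r
  ... | suc _ with cycle-neighbours W un 2≤ e m∈
  ... | y , z , y∈ , z∈ , a , b , y≢z = y≢z (lonely (subst (0 <_) (sym r) (s≤s z≤n)) a b
          (≤-trans (max y∈) (≤-reflexive (sym r))) (≤-trans (max z∈) (≤-reflexive (sym r))))
  -- With greatest rank 0 the whole cycle consists of images of vertices of `H` and pulls back to a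
  -- cycle there.
  extension-acyclic tree lonely {u} P 2≤ e | W@(f ∷ W₀) | un | m , m∈ , max | zero
    with lowest u (n≤0⇒n≡0 (max (here refl)))
  ... | a , refl with pull-walk W (All.tabulate (n≤0⇒n≡0 ∘ max)) refl
  ... | b , refl , W′ , vs , es = IsTree.acyclic tree
        (record { walk = W′ ; distinct = Uniqueₚ.map⁻ (subst Unique (sym vs) un) })
        (subst (2 ≤_) (sym es) 2≤) (reflects e)

-- Fastest temporal paths

module Gaps (Δ : ℕ) where

  -- The least positive wait from residue `a` to residue `b` modulo `Δ`. Equal residues cost a full
  -- period, since times must strictly increase.
  gap : ℕ → ℕ → ℕ
  gap a b with a <? b
  ... | yes _ = b ∸ a
  ... | no  _ = b + Δ ∸ a

  gap>0 : ∀ {a} b → a < Δ → 0 < gap a b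
  gap>0 {a} b a<Δ with a <? b
  ... | yes a<b = m<n⇒0<n∸m a<b
  ... | no  _   = m<n⇒0<n∸m (≤-trans a<Δ (m≤n+m Δ b))

  gap-reaches : ∀ {a} b → a < Δ → ∃[ i ] a + gap a b ≡ b + i * Δ
  gap-reaches {a} b a<Δ with a <? b
  ... | yes a<b = 0 , trans (m+[n∸m]≡n (<⇒≤ a<b)) (sym (+-identityʳ b))
  ... | no  _   = 1 , trans (m+[n∸m]≡n (≤-trans (<⇒≤ a<Δ) (m≤n+m Δ b))) (cong (b +_) (sym (*-identityˡ Δ)))

  gap-≤ : ∀ {a b g} → b + Δ ≤ a + g → gap a b ≤ g
  gap-≤ {a} {b} {g} le with a <? b
  ... | yes _ = m≤n+o⇒m∸n≤o b a (≤-trans (m≤m+n b Δ) le)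
  ... | no  _ = m≤n+o⇒m∸n≤o (b + Δ) a le

  -- Strip a common period from both times until one has none left. Without periods, `0 < g` forces
  -- `a < b`; if only the target has some, it is at least `b + Δ`; if only the start has some, the
  -- target would be at least `Δ`.
  gap-least : ∀ {a b g} i j → a < Δ → b < Δ → 0 < g → a + i * Δ + g ≡ b + j * Δ → gap a b ≤ g
  gap-least {a} {b} {g} zero zero a<Δ b<Δ 0<g e with a <? b
  ... | yes _   = m≤n+o⇒m∸n≤o b a (≤-reflexive (sym (subst₂ (λ p q → p + g ≡ q) (+-identityʳ a) (+-identityʳ b) e)))
  ... | no  a≮b = contradiction
    (≤-trans (≤-trans (≤-reflexive (+-comm 1 a)) (+-monoʳ-≤ a 0<g))
      (≤-reflexive (subst₂ (λ p q → p + g ≡ q) (+-identityʳ a) (+-identityʳ b) e))) a≮b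
  gap-least {a} {b} {g} zero (suc j) a<Δ b<Δ 0<g e = gap-≤ (≤-trans (+-monoʳ-≤ b (m≤m+n Δ (j * Δ)))
    (≤-reflexive (trans (sym e) (cong (_+ g) (+-identityʳ a)))))
  gap-least {a} {b} {g} (suc i) zero a<Δ b<Δ 0<g e = contradiction
    (≤-trans (≤-trans (m≤m+n Δ (i * Δ)) (≤-trans (m≤n+m _ a) (m≤m+n _ g))) (≤-reflexive (trans e (+-identityʳ b)))) (<⇒≱ b<Δ)
  gap-least {a} {b} {g} (suc i) (suc j) a<Δ b<Δ 0<g e = gap-least i j a<Δ b<Δ 0<g
    (+-cancelʳ-≡ Δ _ _ (trans (l a i g Δ) (trans e (r b j Δ))))
    where
    l : ∀ a i g Δ → a + i * Δ + g + Δ ≡ a + (Δ + i * Δ) + g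
    l = solve-∀
    r : ∀ b j Δ → b + (Δ + j * Δ) ≡ b + j * Δ + Δ
    r = solve-∀

  -- a′ − a ≡ c − c′ modulo Δ, without subtraction.
  record Shifted (c c′ a a′ : ℕ) : Set where
    constructor shift
    field
      p q      : ℕ
      congruent : a + c + p * Δ ≡ a′ + c′ + q * Δ

  unshifted : ∀ {a} → Shifted 0 0 a a
  unshifted = shift 0 0 refl

  shifted-sym : ∀ {c c′ a a′} → Shifted c c′ a a′ → Shifted c′ c a′ a
  shifted-sym (shift p q e) = shift q p (sym e)

  -- Waiting `gap a b` after residue `a` ends at residue `b`. Carried along the two congruences, the
  -- same wait leads from `a′` to `b′`, so minimality of `gap a′ b′` applies.
  gap-shifted-≤ : ∀ {c c′ a a′ b b′} → a < Δ → a′ < Δ → b′ < Δ →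
    Shifted c c′ a a′ → Shifted c c′ b b′ → gap a′ b′ ≤ gap a b
  gap-shifted-≤ {c} {c′} {a} {a′} {b} {b′} a<Δ a′<Δ b′<Δ (shift p q e) (shift p′ q′ e′)
    with i , r ← gap-reaches b a<Δ
    = gap-least (q + p′) (q′ + (i + p)) a′<Δ b′<Δ (gap>0 b a<Δ) (+-cancelʳ-≡ c′ _ _ (begin
      a′ + (q + p′) * Δ + gap a b + c′     ≡⟨ l₁ a′ q p′ (gap a b) c′ Δ ⟩
      (a′ + c′ + q * Δ) + (gap a b + p′ * Δ) ≡⟨ cong (_+ (gap a b + p′ * Δ)) e ⟨
      (a + c + p * Δ) + (gap a b + p′ * Δ) ≡⟨ l₂ a c p (gap a b) p′ Δ ⟩
      (a + gap a b) + (c + (p + p′) * Δ)   ≡⟨ cong (_+ (c + (p + p′) * Δ)) r ⟩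
      (b + i * Δ) + (c + (p + p′) * Δ)     ≡⟨ l₃ b i c p p′ Δ ⟩
      (b + c + p′ * Δ) + (i + p) * Δ       ≡⟨ cong (_+ (i + p) * Δ) e′ ⟩
      (b′ + c′ + q′ * Δ) + (i + p) * Δ     ≡⟨ l₄ b′ c′ q′ i p Δ ⟩
      b′ + (q′ + (i + p)) * Δ + c′         ∎))
    where
    open ≡-Reasoning
    l₁ : ∀ a q p g c Δ → a + (q + p) * Δ + g + c ≡ (a + c + q * Δ) + (g + p * Δ)
    l₁ = solve-∀
    l₂ : ∀ a c p g p′ Δ → (a + c + p * Δ) + (g + p′ * Δ) ≡ (a + g) + (c + (p + p′) * Δ)
    l₂ = solve-∀
    l₃ : ∀ b i c p p′ Δ → (b + i * Δ) + (c + (p + p′) * Δ) ≡ (b + c + p′ * Δ) + (i + p) * Δ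
    l₃ = solve-∀
    l₄ : ∀ b c q i p Δ → (b + c + q * Δ) + (i + p) * Δ ≡ b + (q + (i + p)) * Δ + c
    l₄ = solve-∀

  gap-shifted : ∀ {c c′ a a′ b b′} → a < Δ → a′ < Δ → b < Δ → b′ < Δ →
    Shifted c c′ a a′ → Shifted c c′ b b′ → gap a b ≡ gap a′ b′
  gap-shifted a<Δ a′<Δ b<Δ b′<Δ s s′ =
    ≤-antisym (gap-shifted-≤ a′<Δ a<Δ b<Δ (shifted-sym s) (shifted-sym s′)) (gap-shifted-≤ a<Δ a′<Δ b′<Δ s s′)

  carry : ∀ {t a b g} i j → t ≡ a + i * Δ → a + g ≡ b + j * Δ → t + g ≡ b + (j + i) * Δ
  carry {t} {a} {b} {g} i j t≡ r = trans (cong (_+ g) t≡) (trans (l₁ a (i * Δ) g) (trans (cong (_+ i * Δ) r) (l₂ b j i Δ)))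
    where
    l₁ : ∀ a i g → a + i + g ≡ a + g + i
    l₁ = solve-∀
    l₂ : ∀ a j i Δ → a + j * Δ + i * Δ ≡ a + (j + i) * Δ
    l₂ = solve-∀

last : ℕ → List ℕ → ℕ
last t []       = t
last _ (t ∷ ts) = last t ts

-- final names the local function of duration: with t′ ∷ ts generalised to z, its
-- arguments are distinct variables and unification finds it.
private
  mutual
    final : ℕ → List ℕ → ℕ → List ℕ → ℕ
    final = _

    duration-final : ∀ t t′ ts → duration (t ∷ t′ ∷ ts) ≡ final t (t′ ∷ ts) t′ ts + 1 ∸ t
    duration-final t t′ ts with t′ ∷ ts
    ... | z = refl

  final≡last : ∀ t z t′ ts → final t z t′ ts ≡ last t′ ts
  final≡last t z t′ []        = refl
  final≡last t z t′ (t″ ∷ ts) = final≡last t z t″ ts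

duration-last : ∀ t ts → duration (t ∷ ts) ≡ last t ts + 1 ∸ t
duration-last t []        = refl
duration-last t (t′ ∷ ts) = trans (duration-final t t′ ts) (cong (λ l → l + 1 ∸ t) (final≡last t (t′ ∷ ts) t′ ts))

module Timing {Δ : ℕ} where
  open Gaps Δ public

  module _ {n : ℕ} {G : Graph n} (lab : DiLabeling Δ G) where
    open Graph G

    -- The least total wait until the last edge of the walk, counted from a time of residue `a`.
    span : ∀ {u v} → Fin Δ → Walk G u v → ℕ
    span a []      = 0
    span a (_∷_ {u} {v} e W) = gap (toℕ a) (toℕ (lab u v e)) + span (lab u v e) W

    -- The duration of a fastest traversal of W.
    cost : ∀ {u v} → Walk G u v → ℕ
    cost []                  = 0
    cost (_∷_ {u} {v} e W) = suc (span (lab u v e) W)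

    -- `Respects` freed of temporal paths. In a tree the two are equivalent, and this form is easy
    -- to transport along embeddings.
    Fits : (Fin n → Fin n → ℕ ⁺) → Set
    Fits D = ∀ u v → u ≢ v → (P : Path G u v) → fin (cost (Path.walk P)) ≤⁺ D u v

    -- Each actual wait is positive and joins the right residues, so it is no shorter than the
    -- corresponding `gap`.
    span≤ : ∀ {u v} (W : Walk G u v) {t ts} (a : Fin Δ) → ∃[ i ] t ≡ toℕ a + i * Δ →
      Active G lab W ts → Linked _<_ (t ∷ ts) → t + span a W ≤ last t ts
    span≤ []      {t} a _ [] _ = ≤-reflexive (+-identityʳ t)
    span≤ (_∷_ {u} {v} e W) {t} {t′ ∷ ts} a (i , t≡) ((j , t′≡) ∷ act) (t<t′ ∷ inc) = ≤-trans
      (≤-trans (≤-reflexive (sym (+-assoc t _ _))) (+-monoˡ-≤ (span b W) (≤-trans (+-monoʳ-≤ t gap≤) (≤-reflexive t+))))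
      (span≤ W b (j , t′≡) act inc)
      where
      b = lab u v e
      t+ : t + (t′ ∸ t) ≡ t′
      t+ = m+[n∸m]≡n (<⇒≤ t<t′)
      gap≤ : gap (toℕ a) (toℕ b) ≤ t′ ∸ t
      gap≤ = gap-least i j (toℕ<n a) (toℕ<n b) (m<n⇒0<n∸m t<t′)
        (trans (cong (_+ (t′ ∸ t)) (sym t≡)) (trans t+ t′≡))

    cost≤duration : ∀ {u v} (W : Walk G u v) {ts} → Active G lab W ts → Linked _<_ ts → cost W ≤ duration ts
    cost≤duration []      [] _ = z≤n
    cost≤duration (_∷_ {u} {v} e W) {t ∷ ts} (at ∷ act) inc rewrite duration-last t ts =
      m+n≤o⇒m≤o∸n (suc (span (lab u v e) W)) (begin
        suc (span (lab u v e) W) + t   ≡⟨ cong suc (+-comm _ t) ⟩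
        suc (t + span (lab u v e) W)   ≤⟨ s≤s (span≤ W (lab u v e) at act inc) ⟩
        suc (last t ts)                ≡⟨ +-comm 1 _ ⟩
        last t ts + 1                  ∎)
      where open ≤-Reasoning

    -- Taking every edge at its first activation after the previous time attains the lower bound of
    -- `span≤`.
    greedy : ∀ {u v} (W : Walk G u v) t (a : Fin Δ) → ∃[ i ] t ≡ toℕ a + i * Δ →
      ∃[ ts ] Active G lab W ts × Linked _<_ (t ∷ ts) × last t ts ≡ t + span a W
    greedy []      t a _ = [] , [] , [-] , sym (+-identityʳ t)
    greedy (_∷_ {u} {v} e W) t a (i , t≡)
      with j , r ← gap-reaches (toℕ (lab u v e)) (toℕ<n a)
      with ts , act , inc , l ← greedy W (t + gap (toℕ a) (toℕ (lab u v e))) (lab u v e) (j + i , carry i j t≡ r)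
      = _ ∷ ts , (j + i , carry i j t≡ r) ∷ act ,
        ≤-trans (≤-reflexive (+-comm 1 t)) (+-monoʳ-≤ t (gap>0 (toℕ (lab u v e)) (toℕ<n a))) ∷ inc ,
        trans l (+-assoc t _ _)

    traversal : ∀ {u v} (P : Path G u v) → u ≢ v →
      Σ[ Q ∈ TemporalPath G lab u v ] duration (TemporalPath.times Q) ≡ cost (Path.walk P)
    traversal P u≢v with Path.walk P in eq
    ... | [] = contradiction refl u≢v
    ... | _∷_ {u} {v} e W with ts , act , inc , l ← greedy W (toℕ (lab u v e)) (lab u v e) (0 , sym (+-identityʳ _))
      = record { path = P ; times = toℕ (lab u v e) ∷ ts
               ; active = subst (λ W → Active G lab W _) (sym eq) ((0 , sym (+-identityʳ _)) ∷ act) ; increasing = inc } ,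
        trans (duration-last (toℕ (lab u v e)) ts) (trans (cong (λ x → x + 1 ∸ toℕ (lab u v e)) l)
          (trans (cong (_∸ toℕ (lab u v e)) (trans (+-assoc (toℕ (lab u v e)) _ 1) (cong (toℕ (lab u v e) +_) (+-comm _ 1)))) (m+n∸m≡n (toℕ (lab u v e)) _)))

    module _ (tree : IsTree G) {D : Fin n → Fin n → ℕ ⁺} where
      open TemporalPath

      cost-least : ∀ {u v} (P : Path G u v) (Q : TemporalPath G lab u v) → cost (Path.walk P) ≤ duration (times Q)
      cost-least P Q = subst (λ W → cost W ≤ duration (times Q)) (same-path tree (path Q) P)
        (cost≤duration (Path.walk (path Q)) (active Q) (increasing Q))

      fits⇒respects : Fits D → Respects G lab D
      fits⇒respects fits u v u≢v with Q , d ← traversal (IsTree.connected tree u v) u≢v =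
        Q , (λ R → subst (_≤ duration (times R)) (sym d) (cost-least (IsTree.connected tree u v) R)) ,
        subst (λ c → fin c ≤⁺ D u v) (sym d) (fits u v u≢v (IsTree.connected tree u v))

      respects⇒fits : Respects G lab D → Fits D
      respects⇒fits resp u v u≢v P with Q , _ , Q≤ ← resp u v u≢v = ≤⁺-trans ≤-trans (fin≤ (cost-least P Q)) Q≤

-- Transport of paths, distances and durations along embeddings

module Embedding {m n : ℕ} {H : Graph m} {G : Graph n} (φ : Fin m → Fin n)
  (hom : ∀ {x y} → Graph.Adj H x y → Graph.Adj G (φ x) (φ y)) where

  image : ∀ {x y} → Walk H x y → Walk G (φ x) (φ y)
  image []      = []
  image (e ∷ W) = hom e ∷ image W

  vertices-image : ∀ {x y} (W : Walk H x y) → vertices (image W) ≡ List.map φ (vertices W)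
  vertices-image []      = refl
  vertices-image (e ∷ W) = cong (_ ∷_) (vertices-image W)

  edges-image : ∀ {x y} (W : Walk H x y) → edges (image W) ≡ edges W
  edges-image []      = refl
  edges-image (e ∷ W) = cong suc (edges-image W)

  module _ (injective : ∀ {x y} → φ x ≡ φ y → x ≡ y) where

    image-path : ∀ {x y} → Path H x y → Path G (φ x) (φ y)
    image-path P = record
      { walk     = image (Path.walk P)
      ; distinct = subst Unique (sym (vertices-image (Path.walk P))) (Uniqueₚ.map⁺ injective (Path.distinct P)) }

    -- The image of the path in `H` is the only path between the images, so distances do not shrink
    -- in the larger tree. This carries the lower bounds on matrix entries over to the glued
    -- instance.
    image-distance : IsTree H → IsTree G → ∀ {x y d} → IsDistance G (φ x) (φ y) d → IsDistance H x y d
    image-distance treeH treeG {x} {y} ((P , refl) , _) = subst (IsDistance H x y)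
      (trans (sym (edges-image (Path.walk Q))) (cong edges (same-path treeG (image-path Q) P))) (path-distance treeH Q)
      where Q = IsTree.connected treeH x y

  module _ {Δ : ℕ} (lab : DiLabeling Δ H) (lab′ : DiLabeling Δ G) {c c′ : ℕ}
    (shifted : ∀ {x y} (e : Graph.Adj H x y) → Gaps.Shifted Δ c c′ (toℕ (lab x y e)) (toℕ (lab′ (φ x) (φ y) (hom e)))) where
    open Timing {Δ}

    -- Gaps survive a common shift; the residue of the starting time has to be shifted along with
    -- the labels.
    span-image : ∀ {x y a a′} (W : Walk H x y) → Shifted c c′ (toℕ a) (toℕ a′) → span lab′ a′ (image W) ≡ span lab a W
    span-image []      s = refl
    span-image {a = a} {a′} (_∷_ {x} {y} e W) s = cong₂ _+_
      (sym (gap-shifted (toℕ<n a) (toℕ<n a′) (toℕ<n (lab x y e)) (toℕ<n (lab′ (φ x) (φ y) (hom e))) s (shifted e)))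
      (span-image W (shifted e))

    cost-image : ∀ {x y} (W : Walk H x y) → cost lab′ (image W) ≡ cost lab W
    cost-image []      = refl
    cost-image (e ∷ W) = cong suc (span-image W (shifted e))

-- The glued tree

does⁻ : ∀ {P : Set} (p? : Dec P) → T (does p?) → P
does⁻ (yes p) _ = p

does⁺ : ∀ {P : Set} (p? : Dec P) → P → T (does p?)
does⁺ (yes _) _ = tt
does⁺ (no ¬p) p = ¬p p

data Vertex (n m : ℕ) : Set where
  base : Fin n → Vertex n m
  new  : (u v : Fin n) → Fin m → Vertex n m

module _ {n m : ℕ} where

  -- The block of `u` holds `base u` and then the `n * m` copies `new u v x`. Even `v₁` and `v₂` get
  -- a copy, so the numbering has no holes and follows the order of nested loops over `u`, `v` and
  -- `x`.
  number : Vertex n m → Fin (n * suc (n * m))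
  number (base u)    = combine u zero
  number (new u v x) = combine u (suc (combine v x))

  from-block : Fin n × Fin (suc (n * m)) → Vertex n m
  from-block (u , zero)  = base u
  from-block (u , suc j) = uncurry (new u) (remQuot m j)

  vertex : Fin (n * suc (n * m)) → Vertex n m
  vertex i = from-block (remQuot (suc (n * m)) i)

  vertex-number : ∀ r → vertex (number r) ≡ r
  vertex-number (base u)    = cong from-block (remQuot-combine u zero)
  vertex-number (new u v x) = trans (cong from-block (remQuot-combine u (suc (combine v x))))
                                    (cong (uncurry (new u)) (remQuot-combine v x))

  number-vertex : ∀ i → number (vertex i) ≡ i
  number-vertex i = trans (number-from-block (remQuot (suc (n * m)) i)) (combine-remQuot {n} (suc (n * m)) i)
    where
    number-from-block : ∀ b → number (from-block b) ≡ uncurry combine b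
    number-from-block (u , zero)  = refl
    number-from-block (u , suc j) = cong (combine u ∘ suc) (combine-remQuot {n} m j)

  number-injective : ∀ {r s} → number r ≡ number s → r ≡ s
  number-injective {r} {s} e = trans (sym (vertex-number r)) (trans (cong vertex e) (vertex-number s))

  vertex-injective : ∀ {i j} → vertex i ≡ vertex j → i ≡ j
  vertex-injective {i} {j} e = trans (sym (number-vertex i)) (trans (cong number e) (number-vertex j))

module _ {Δ n : ℕ} {G : Graph n} (0<Δ : 0 < Δ) (lab : DiLabeling Δ G) where

  -- Extends a labeling to all pairs, with label 0 off the edges, so that labels of the glued tree
  -- can be defined from the shape of two vertices without a proof of adjacency.
  total : Fin n → Fin n → Fin Δ
  total u v with T? (Graph.adj G u v)
  ... | yes e = lab u v e
  ... | no  _ = fromℕ< 0<Δ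

  total-edge : ∀ {u v} (e : Graph.Adj G u v) → total u v ≡ lab u v e
  total-edge {u} {v} e with T? (Graph.adj G u v)
  ... | yes _ = refl
  ... | no ¬e = contradiction e ¬e

lab-cong : ∀ {Δ n} {G : Graph n} (lab : DiLabeling Δ G) {u u′ v v′} → u ≡ u′ → v ≡ v′ →
  (e : Graph.Adj G u v) (e′ : Graph.Adj G u′ v′) → lab u v e ≡ lab u′ v′ e′
lab-cong lab refl refl e e′ = refl

-- Where a gadget vertex hangs: at the copy of v₁, at that of v₂, or at other vertices of the gadget.
data Link : Set where
  side₁ side₂ far : Link

module Attaching {Δ k : ℕ} (Ĝ : Gadget Δ k) where
  open Gadget Ĝ renaming (n to m; G to H; D to E; isTree to treeH; positive to positiveH; bound to boundH)
  open Graph H renaming (adj to adjH; Adj to AdjH; symmetric to symH; irreflexive to irrH)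

  Core : Fin m → Set
  Core x = x ≡ v₁ ⊎ x ≡ v₂

  core? : ∀ x → Dec (Core x)
  core? x with x ≟ v₁ | x ≟ v₂
  ... | yes e | _     = yes (inj₁ e)
  ... | no _  | yes e = yes (inj₂ e)
  ... | no ¬e | no ¬f = no [ ¬e , ¬f ]′

  core : Fin m → Bool
  core x = does (core? x)

  -- v₁ and v₂ are identified with vertices of the tree; their own copies become leaves.
  link : Fin m → Link
  link x = if core x then side₁ else if adjH x v₁ then side₁ else if adjH x v₂ then side₂ else far

  data LinkView (x : Fin m) : Link → Set where
    hub   : Core x → LinkView x side₁
    near₁ : ¬ Core x → AdjH x v₁ → LinkView x side₁
    near₂ : ¬ Core x → ¬ AdjH x v₁ → AdjH x v₂ → LinkView x side₂
    far   : ¬ Core x → ¬ AdjH x v₁ → ¬ AdjH x v₂ → LinkView x far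

  link-view : ∀ x → LinkView x (link x)
  link-view x with core? x | adjH x v₁ in p | adjH x v₂ in q
  ... | yes c | _     | _     = hub c
  ... | no ¬c | true  | _     = near₁ ¬c (subst T (sym p) tt)
  ... | no ¬c | false | true  = near₂ ¬c (subst T p) (subst T (sym q) tt)
  ... | no ¬c | false | false = far ¬c (subst T p) (subst T q)

  -- The path `v₁`, `y`, `v₂` would be closed by the edge between `v₂` and `v₁`. Hence the order of
  -- the tests in `link` does not matter outside the core.
  no-triangle : ∀ {y} → ¬ Core y → AdjH y v₁ → ¬ AdjH y v₂
  no-triangle ¬c a b = IsTree.acyclic treeH
    (record { walk = symH a ∷ b ∷ []
            ; distinct = ((λ e → ¬c (inj₁ (sym e))) ∷ nonloop {G = H} adjacent ∷ []) ∷ ((λ e → ¬c (inj₂ e)) ∷ []) ∷ ([] ∷ []) })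
    (s≤s (s≤s z≤n)) (symH adjacent)

  link-near₁ : ∀ {y} → ¬ Core y → AdjH y v₁ → link y ≡ side₁
  link-near₁ {y} ¬c a with link y | link-view y
  ... | _ | hub c         = contradiction c ¬c
  ... | _ | near₁ _ _     = refl
  ... | _ | near₂ _ ¬a _  = contradiction a ¬a
  ... | _ | far _ ¬a _    = contradiction a ¬a

  link-near₂ : ∀ {y} → ¬ Core y → AdjH y v₂ → link y ≡ side₂
  link-near₂ {y} ¬c b with link y | link-view y
  ... | _ | hub c         = contradiction c ¬c
  ... | _ | near₁ _ a     = contradiction b (no-triangle ¬c a)
  ... | _ | near₂ _ _ _   = refl
  ... | _ | far _ _ ¬b    = contradiction b ¬b

  -- The edges that stay inside a copy; gadget edges with an end at `v₁` or `v₂` go to the tree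
  -- vertices instead.
  inner : Fin m → Fin m → Bool
  inner x y = not (core x) ∧ not (core y) ∧ adjH x y

  inner⁺ : ∀ {x y} → ¬ Core x → ¬ Core y → AdjH x y → T (inner x y)
  inner⁺ {x} {y} ¬c ¬c′ a with core? x | core? y
  ... | yes c | _      = contradiction c ¬c
  ... | no _  | yes c′ = contradiction c′ ¬c′
  ... | no _  | no _   = a

  inner⁻ : ∀ {x y} → T (inner x y) → ¬ Core x × ¬ Core y × AdjH x y
  inner⁻ {x} {y} t with core? x | core? y
  ... | no ¬c | no ¬c′ = ¬c , ¬c′ , t

  module _ {n : ℕ} where

    joined : Link → (w u v : Fin n) → Bool
    joined side₁ w u v = does (w ≟ u)
    joined side₂ w u v = does (w ≟ v)
    joined far   w u v = false

    joined-unique : ∀ l {w w′ u v} → T (joined l w u v) → T (joined l w′ u v) → w ≡ w′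
    joined-unique side₁ {w} {w′} {z} {_} t t′ = trans (does⁻ (w ≟ z) t) (sym (does⁻ (w′ ≟ z) t′))
    joined-unique side₂ {w} {w′} {_} {z} t t′ = trans (does⁻ (w ≟ z) t) (sym (does⁻ (w′ ≟ z) t′))

    module _ (adj : Fin n → Fin n → Bool) where

      adjV : Vertex n m → Vertex n m → Bool
      adjV (base a)    (base b)       = adj a b
      adjV (base w)    (new u v y)    = joined (link y) w u v
      adjV (new u v x) (base w)       = joined (link x) w u v
      adjV (new u v x) (new u′ v′ y)  = does (u ≟ u′) ∧ does (v ≟ v′) ∧ inner x y

    -- The gadget vertex whose copy for the pair (u , v) is the given vertex.
    origin : (u v : Fin n) → Vertex n m → Maybe (Fin m)
    origin u v (base w)      = if does (w ≟ u) then just v₁ else if does (w ≟ v) then just v₂ else nothing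
    origin u v (new u′ v′ x) =
      if does (u′ ≟ u) then (if does (v′ ≟ v) then (if core x then nothing else just x) else nothing) else nothing

    entryH : Maybe (Fin m) → Maybe (Fin m) → ℕ ⁺
    entryH (just x) (just y) = E x y
    entryH _        _        = ⊤⁺

    module _ (adj : Fin n → Fin n → Bool) (D : Fin n → Fin n → ℕ ⁺) where

      copied : (u v : Fin n) (r s : Vertex n m) → ℕ ⁺
      copied u v r s = if adj u v then entryH (origin u v r) (origin u v s) else ⊤⁺

      -- A new vertex names the only copy that can impose a bound on it; if the other vertex lies
      -- outside that copy, `origin` turns the entry into `⊤⁺`. Between base vertices `D` alone
      -- counts, and the gadget's entries for `v₁` and `v₂` are dropped.
      boundV : Vertex n m → Vertex n m → ℕ ⁺
      boundV (base a)      (base b)      = D a b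
      boundV r@(base _)    s@(new u v _) = copied u v r s
      boundV r@(new u v _) s             = copied u v r s

  module Glued (I : Instance k) where
    open Instance I
    open Graph G

    V : Set
    V = Vertex n m

    AdjV : V → V → Set
    AdjV r s = T (adjV adj r s)

    new-new⁻ : ∀ {u v x u′ v′ y} → AdjV (new u v x) (new u′ v′ y) →
      u ≡ u′ × v ≡ v′ × ¬ Core x × ¬ Core y × AdjH x y
    new-new⁻ {u} {v} {x} {u′} {v′} {y} t with u ≟ u′ | v ≟ v′
    ... | yes e | yes e′ = e , e′ , inner⁻ t

    new-new⁺ : ∀ {u v x y} → ¬ Core x → ¬ Core y → AdjH x y → AdjV (new u v x) (new u v y)
    new-new⁺ {u} {v} ¬c ¬c′ a with u ≟ u | v ≟ v
    ... | yes _  | yes _  = inner⁺ ¬c ¬c′ a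
    ... | no u≢u | _      = contradiction refl u≢u
    ... | yes _  | no v≢v = contradiction refl v≢v

    symV : ∀ r s → AdjV r s → AdjV s r
    symV (base a)    (base b)      t = symmetric t
    symV (base w)    (new u v y)   t = t
    symV (new u v x) (base w)      t = t
    symV (new u v x) (new u′ v′ y) t with new-new⁻ {u} {v} {x} {u′} {v′} {y} t
    ... | refl , refl , ¬c , ¬c′ , a = new-new⁺ {u} {v} ¬c′ ¬c (symH a)

    irrV : ∀ r → ¬ AdjV r r
    irrV (base a)    t = irreflexive t
    irrV (new u v x) t = irrH (proj₂ (proj₂ (proj₂ (proj₂ (new-new⁻ {u} {v} {x} {u} {v} {x} t)))))

    N : ℕ
    N = n * suc (n * m)

    G′ : Graph N
    G′ = record
      { adj         = λ i j → adjV adj (vertex i) (vertex j)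
      ; symmetric   = λ {i} {j} → symV (vertex i) (vertex j)
      ; irreflexive = λ {i} → irrV (vertex i) }

    number-edge : ∀ r s → AdjV r s → Graph.Adj G′ (number r) (number s)
    number-edge r s = subst₂ AdjV (sym (vertex-number r)) (sym (vertex-number s))

    edge-number : ∀ r s → Graph.Adj G′ (number r) (number s) → AdjV r s
    edge-number r s = subst₂ AdjV (vertex-number r) (vertex-number s)

    ι : Fin n → Fin N
    ι a = number (base a)

    ι-edge : ∀ {a b} → Adj a b → Graph.Adj G′ (ι a) (ι b)
    ι-edge {a} {b} = number-edge (base a) (base b)

    ι-injective : ∀ {a b} → ι a ≡ ι b → a ≡ b
    ι-injective {a} {b} e with refl ← number-injective {r = base a} {base b} e = refl

    module ι = Embedding {H = G} {G = G′} ι (λ {a} {b} → ι-edge {a} {b})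

    -- Tree vertices lie at the bottom, copies are ranked by their depth in the gadget rooted at
    -- `v₁`. This makes `extension-acyclic` applicable with the tree as the part of rank 0.
    rankV : V → ℕ
    rankV (base _)    = 0
    rankV (new u v x) = suc (depth treeH v₁ x)

    -- Here `y` is the parent of `x`. Since `v₁` has depth 0 and `v₂` depth 1, a neighbour of `x`
    -- among them would be no deeper than `x`, hence also the parent, and `y` would be in the core.
    no-lower-core : ∀ {x y} → ¬ Core x → ¬ Core y → AdjH x y → depth treeH v₁ y ≤ depth treeH v₁ x →
      ¬ AdjH x v₁ × ¬ AdjH x v₂
    no-lower-core {x} {y} ¬c ¬c′ a y≤x =
      (λ b → ¬c′ (inj₁ (ascend-unique treeH a b y≤x (≤-trans (≤-reflexive (depth-root treeH v₁)) z≤n)))) ,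
      (λ b → ¬c′ (inj₂ (ascend-unique treeH a b y≤x
         (≤-trans (≤-reflexive (depth-edge treeH (symH adjacent))) (depth>0 treeH (¬c ∘ inj₁))))))

    -- A vertex joined to the tree is either a leaf copy of the core, which has no inner edges, or
    -- the copy of a neighbour of the core; the latter has its parent in the core.
    not-both : ∀ {u v x w y u′ v′} → AdjV (new u v x) (base w) → AdjV (new u v x) (new u′ v′ y) →
      ¬ depth treeH v₁ y ≤ depth treeH v₁ x
    not-both {u} {v} {x} {w} {y} {u′} {v′} t t′ y≤x
      with _ , _ , ¬c , ¬c′ , a ← new-new⁻ {u} {v} {x} {u′} {v′} {y} t′
      with ¬1 , ¬2 ← no-lower-core ¬c ¬c′ a y≤x
      with link x | link-view x
    ... | _ | hub c        = ¬c c
    ... | _ | near₁ _ b    = ¬1 b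
    ... | _ | near₂ _ _ b  = ¬2 b

    lonely : ∀ r s t → 0 < rankV r → AdjV r s → AdjV r t → rankV s ≤ rankV r → rankV t ≤ rankV r → s ≡ t
    lonely (new u v x) (base w) (base w′) _ a b _ _ = cong base (joined-unique (link x) a b)
    lonely (new u v x) (base w) (new u′ v′ y) _ a b _ (s≤s y≤x) =
      contradiction y≤x (not-both {u} {v} {x} {w} {y} {u′} {v′} a b)
    lonely (new u v x) (new u′ v′ y) (base w) _ a b (s≤s y≤x) _ =
      contradiction y≤x (not-both {u} {v} {x} {w} {y} {u′} {v′} b a)
    lonely (new u v x) (new u′ v′ y) (new u″ v″ z) _ a b (s≤s y≤x) (s≤s z≤x)
      with refl , refl , _ , _ , a′ ← new-new⁻ {u} {v} {x} {u′} {v′} {y} a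
      with refl , refl , _ , _ , b′ ← new-new⁻ {u} {v} {x} {u″} {v″} {z} b
      = cong (new u v) (ascend-unique treeH a′ b′ y≤x z≤x)

    -- Follow the gadget's path towards `v₁` and stop at the first vertex joined to the tree. A
    -- `far` vertex has no neighbour in the core, so each step taken is an inner edge.
    to-base : ∀ u v {x} → Walk H x v₁ → ∃[ w ] Walk G′ (number (new u v x)) (ι w)
    to-base u v {x} W with link x in l | link-view x
    ... | side₁ | _ = u , number-edge (new u v x) (base u) (subst (λ l → T (joined l u u v)) (sym l) (does⁺ (u ≟ u) refl)) ∷ []
    ... | side₂ | _ = v , number-edge (new u v x) (base v) (subst (λ l → T (joined l v u v)) (sym l) (does⁺ (v ≟ v) refl)) ∷ []
    to-base u v {x} []      | far | far ¬c _ _ = contradiction (inj₁ refl) ¬c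
    to-base u v {x} (_∷_ {v = y} e W) | far | far ¬c ¬1 ¬2 with to-base u v W
    ... | w , W′ = w , number-edge (new u v x) (new u v y) (new-new⁺ {u} {v} ¬c
            [ (λ { refl → ¬1 e }) , (λ { refl → ¬2 e }) ]′ e) ∷ W′

    descend : ∀ r → ∃[ w ] Walk G′ (number r) (ι w)
    descend (base w)    = w , []
    descend (new u v x) = to-base u v (Path.walk (IsTree.connected treeH x v₁))

    G′-tree : IsTree G′
    G′-tree = record
      { nonempty  = ≤-trans (IsTree.nonempty isTree) (m≤m*n n (suc (n * m)))
      ; connected = connected′
      ; acyclic   = extension-acyclic ι (λ {a} {b} → edge-number (base a) (base b)) (rankV ∘ vertex) lowest isTree
          (λ {x} {y} {z} pos a b p q → vertex-injective (lonely (vertex x) (vertex y) (vertex z) pos a b p q)) }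
      where
      connected′ : ∀ i j → Path G′ i j
      connected′ i j with descend (vertex i) | descend (vertex j)
      ... | a , W | b , W′ = subst₂ (Path G′) (number-vertex {n} {m} i) (number-vertex {n} {m} j)
        (proj₁ (erase (W ⊕ (ι.image (Path.walk (IsTree.connected isTree a b)) ⊕ backward W′))))
      lowestV : ∀ r → rankV r ≡ 0 → ∃[ a ] r ≡ base a
      lowestV (base a) _ = a , refl
      lowest : ∀ i → rankV (vertex i) ≡ 0 → ∃[ a ] i ≡ ι a
      lowest i e with a , eq ← lowestV (vertex i) e = a , trans (sym (number-vertex {n} {m} i)) (cong number eq)

-- Equivalence of the given instance and the glued instance

module Correspondence {Δ k : ℕ} (Ĝ : Gadget Δ k) (I : Instance k) where
  open Attaching Ĝ
  open Glued I
  open Gadget Ĝ using (v₁; v₂; adjacent; enforces; realizable)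
    renaming (n to m; G to H; D to E; isTree to treeH; positive to positiveH; bound to boundH)
  open Graph H renaming (adj to adjH; Adj to AdjH; symmetric to symH; irreflexive to irrH)
  open Instance I
  open Graph G

  module _ (u v : Fin n) where

    -- The gadget embedded as its copy for `(u , v)`: `v₁` and `v₂` go to the tree vertices, not to
    -- their own leaf copies.
    φ : Fin m → V
    φ x with x ≟ v₁ | x ≟ v₂
    ... | yes _ | _     = base u
    ... | no _  | yes _ = base v
    ... | no _  | no _  = new u v x

    data φ-View : Fin m → V → Set where
      is-v₁ : φ-View v₁ (base u)
      is-v₂ : φ-View v₂ (base v)
      other : ∀ {x} → ¬ Core x → φ-View x (new u v x)

    φ-view : ∀ x → φ-View x (φ x)
    φ-view x with x ≟ v₁ | x ≟ v₂
    ... | yes refl | _        = is-v₁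
    ... | no _     | yes refl = is-v₂
    ... | no ¬1    | no ¬2    = other [ ¬1 , ¬2 ]′

    φ-v₁ : φ v₁ ≡ base u
    φ-v₁ with v₁ ≟ v₁
    ... | yes _ = refl
    ... | no ¬e = contradiction refl ¬e

    φ-v₂ : φ v₂ ≡ base v
    φ-v₂ with v₂ ≟ v₁ | v₂ ≟ v₂
    ... | yes e | _     = contradiction (sym e) (nonloop {G = H} adjacent)
    ... | no _  | yes _ = refl
    ... | no _  | no ¬e = contradiction refl ¬e

    joined-near₁ : ∀ {y} → ¬ Core y → AdjH y v₁ → AdjV (base u) (new u v y)
    joined-near₁ ¬c a rewrite link-near₁ ¬c a = does⁺ (u ≟ u) refl

    joined-near₂ : ∀ {y} → ¬ Core y → AdjH y v₂ → AdjV (base v) (new u v y)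
    joined-near₂ ¬c a rewrite link-near₂ ¬c a = does⁺ (v ≟ v) refl

    origin-sound : ∀ r {x} → origin u v r ≡ just x → r ≡ φ x
    origin-sound (base w) e with w ≟ u | w ≟ v
    origin-sound (base w) refl | yes refl | _        = sym φ-v₁
    origin-sound (base w) refl | no _     | yes refl = sym φ-v₂
    origin-sound (new u′ v′ x) e with u′ ≟ u | v′ ≟ v | core? x in c
    origin-sound (new _ _ x) refl | yes refl | yes refl | no ¬c with φ x | φ-view x
    ... | _ | is-v₁   = contradiction (inj₁ refl) ¬c
    ... | _ | is-v₂   = contradiction (inj₂ refl) ¬c
    ... | _ | other _ = refl

    copied-adjacent : Adj u v → ∀ r s → copied adj D u v r s ≡ entryH {n} (origin u v r) (origin u v s)
    copied-adjacent uv r s with adj u v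
    ... | true = refl

    module _ (uv : Adj u v) where

      φ-hom : ∀ {x y} → AdjH x y → AdjV (φ x) (φ y)
      φ-hom {x} {y} a with φ x | φ-view x | φ y | φ-view y
      ... | _ | is-v₁    | _ | is-v₁     = contradiction a irrH
      ... | _ | is-v₁    | _ | is-v₂     = uv
      ... | _ | is-v₁    | _ | other ¬c  = joined-near₁ ¬c (symH a)
      ... | _ | is-v₂    | _ | is-v₁     = symmetric uv
      ... | _ | is-v₂    | _ | is-v₂     = contradiction a irrH
      ... | _ | is-v₂    | _ | other ¬c  = joined-near₂ ¬c (symH a)
      ... | _ | other ¬c | _ | is-v₁     = joined-near₁ ¬c a
      ... | _ | other ¬c | _ | is-v₂     = joined-near₂ ¬c a
      ... | _ | other ¬c | _ | other ¬c′ = new-new⁺ {u} {v} ¬c ¬c′ a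

      φ-injective : ∀ {x y} → φ x ≡ φ y → x ≡ y
      φ-injective {x} {y} e with φ x | φ-view x | φ y | φ-view y
      φ-injective refl | _ | is-v₁   | _ | is-v₁   = refl
      φ-injective refl | _ | is-v₁   | _ | is-v₂   = contradiction uv irreflexive
      φ-injective refl | _ | is-v₂   | _ | is-v₁   = contradiction uv irreflexive
      φ-injective refl | _ | is-v₂   | _ | is-v₂   = refl
      φ-injective refl | _ | other _ | _ | other _ = refl

      origin-φ : ∀ x → origin u v (φ x) ≡ just x
      origin-φ x with φ x | φ-view x
      ... | _ | is-v₁ with u ≟ u
      ... | yes _ = refl
      ... | no ¬e = contradiction refl ¬e
      origin-φ x | _ | is-v₂ with v ≟ u | v ≟ v
      ... | yes e | _     = contradiction (sym e) (nonloop {G = G} uv)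
      ... | no _  | yes _ = refl
      ... | no _  | no ¬e = contradiction refl ¬e
      origin-φ x | _ | other ¬c with u ≟ u | v ≟ v | core? x
      ... | yes _ | yes _ | no _  = refl
      ... | no ¬e | _     | _     = contradiction refl ¬e
      ... | yes _ | no ¬e | _     = contradiction refl ¬e
      ... | yes _ | yes _ | yes c = contradiction c ¬c

      copied-φ : ∀ x y → copied adj D u v (φ x) (φ y) ≡ E x y
      copied-φ x y = trans (copied-adjacent uv (φ x) (φ y)) (cong₂ (entryH {n}) (origin-φ x) (origin-φ y))

      -- Two core vertices are excluded because between their images `boundV` returns the entry of
      -- `D`.
      boundV-φ : ∀ {x y} → ¬ (Core x × Core y) → boundV adj D (φ x) (φ y) ≡ E x y
      boundV-φ {x} {y} ¬c = trans (with-owner ¬c) (copied-φ x y)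
        where
        with-owner : ¬ (Core x × Core y) → boundV adj D (φ x) (φ y) ≡ copied adj D u v (φ x) (φ y)
        with-owner ¬c with φ x | φ-view x | φ y | φ-view y
        ... | _ | other _ | _ | _       = refl
        ... | _ | is-v₁   | _ | other _ = refl
        ... | _ | is-v₂   | _ | other _ = refl
        ... | _ | is-v₁   | _ | is-v₁   = contradiction (inj₁ refl , inj₁ refl) ¬c
        ... | _ | is-v₁   | _ | is-v₂   = contradiction (inj₁ refl , inj₂ refl) ¬c
        ... | _ | is-v₂   | _ | is-v₁   = contradiction (inj₂ refl , inj₁ refl) ¬c
        ... | _ | is-v₂   | _ | is-v₂   = contradiction (inj₂ refl , inj₂ refl) ¬c

      ψ : Fin m → Fin N
      ψ x = number (φ x)

      ψ-hom : ∀ {x y} → AdjH x y → Graph.Adj G′ (ψ x) (ψ y)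
      ψ-hom {x} {y} a = number-edge (φ x) (φ y) (φ-hom a)

      ψ-injective : ∀ {x y} → ψ x ≡ ψ y → x ≡ y
      ψ-injective {x} {y} e = φ-injective (number-injective {r = φ x} {φ y} e)

      module ψ = Embedding {H = H} {G = G′} ψ (λ {x} {y} → ψ-hom {x} {y})

  -- The possible sources of an entry. Vertices of a gadget entry are given as images under `φ`, so
  -- that distances and durations can be compared with those in the gadget.
  data Bound : V → V → ℕ ⁺ → Set where
    old       : ∀ a b → Bound (base a) (base b) (D a b)
    unbounded : ∀ {r s} → Bound r s ⊤⁺
    gadget    : ∀ {u v} → Adj u v → ∀ x y → Bound (φ u v x) (φ u v y) (E x y)

  copied-bound : ∀ u v r s → Bound r s (copied adj D u v r s)
  copied-bound u v r s with adj u v in uv | origin u v r in p | origin u v s in q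
  ... | false | _       | _       = unbounded
  ... | true  | nothing | _       = unbounded
  ... | true  | just x  | nothing = unbounded
  ... | true  | just x  | just y  = subst₂ (λ r s → Bound r s (E x y)) (sym (origin-sound u v r p)) (sym (origin-sound u v s q))
                                      (gadget (subst T (sym uv) tt) x y)

  bound-view : ∀ r s → Bound r s (boundV adj D r s)
  bound-view (base a)    (base b)    = old a b
  bound-view (base a)    (new u v x) = copied-bound u v (base a) (new u v x)
  bound-view (new u v x) s           = copied-bound u v (new u v x) s

  D′ : Fin N → Fin N → ℕ ⁺
  D′ i j = boundV adj D (vertex i) (vertex j)

  D′-number : ∀ r s → D′ (number r) (number s) ≡ boundV adj D r s
  D′-number r s = cong₂ (boundV adj D) (vertex-number r) (vertex-number s)

  by-vertices : (P : Fin N → Fin N → ℕ ⁺ → Set) → (∀ r s → P (number r) (number s) (boundV adj D r s)) → ∀ i j → P i j (D′ i j)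
  by-vertices P p i j = subst₂ (λ i′ j′ → P i′ j′ (D′ i j)) (number-vertex {n} {m} i) (number-vertex {n} {m} j) (p (vertex i) (vertex j))

  reduced : Instance k
  reduced = record
    { n        = N
    ; G        = G′
    ; isTree   = G′-tree
    ; D        = D′
    ; positive = λ i j → positive′ (bound-view (vertex i) (vertex j))
    ; bound    = by-vertices (λ i j b → i ≢ j → ∀ d → IsDistance G′ i j d → fin (d + k) ≤⁺ b) λ r s → bound′ (bound-view r s)
    }
    where
    positive′ : ∀ {r s b} → Bound r s b → fin 1 ≤⁺ b
    positive′ (old a b)      = positive a b
    positive′ unbounded      = _ ≤⊤⁺
    positive′ (gadget _ x y) = positiveH x y
    bound′ : ∀ {r s b} → Bound r s b → number r ≢ number s → ∀ d → IsDistance G′ (number r) (number s) d → fin (d + k) ≤⁺ b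
    bound′ (old a b) a≢b d dist = bound a b (a≢b ∘ cong ι) d (ι.image-distance (λ {a} {b} → ι-injective {a} {b}) isTree G′-tree dist)
    bound′ unbounded _ _ _ = _ ≤⊤⁺
    bound′ (gadget {u} {v} uv x y) x≢y d dist = boundH x y (x≢y ∘ cong (ψ u v uv)) d
      (ψ.image-distance u v uv (ψ-injective u v uv) treeH G′-tree dist)

  open Timing {Δ}

  backwards : DiRealizable Δ reduced → Realizable Δ I
  backwards (l′ , resp) = record { label = l ; unoriented = symmetric-label } , fits⇒respects l isTree fits
    where
    l : DiLabeling Δ G
    l a b e = l′ (ι a) (ι b) (ι-edge {a} {b} e)
    fits′ : Fits l′ D′
    fits′ = respects⇒fits l′ G′-tree resp
    fits : Fits l D
    fits a b a≢b P = subst₂ (λ c d → fin c ≤⁺ d) (ι.cost-image l l′ (λ _ → unshifted) (Path.walk P)) (D′-number (base a) (base b))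
      (fits′ (ι a) (ι b) (a≢b ∘ ι-injective) (ι.image-path (λ {a} {b} → ι-injective {a} {b}) P))
    module _ (u v : Fin n) (uv : Adj u v) where
      lH : DiLabeling Δ H
      lH x y e = l′ (ψ u v uv x) (ψ u v uv y) (ψ-hom u v uv {x} {y} e)
      -- Makes up for the dropped entries between `v₁` and `v₂`: the path is one edge, its duration
      -- is 1, and entries are positive.
      short : ∀ {x y} (e : AdjH x y) (P : Path H x y) → fin (cost lH (Path.walk P)) ≤⁺ E x y
      short {x} {y} e P rewrite same-path treeH P (edge-path e) = positiveH x y
      off-core : ∀ {x y} → x ≢ y → ¬ (Core x × Core y) → (P : Path H x y) → fin (cost lH (Path.walk P)) ≤⁺ E x y
      off-core {x} {y} x≢y ¬c P = subst₂ (λ c d → fin c ≤⁺ d) (ψ.cost-image u v uv lH l′ (λ _ → unshifted) (Path.walk P))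
        (trans (D′-number (φ u v x) (φ u v y)) (boundV-φ u v uv ¬c))
        (fits′ (ψ u v uv x) (ψ u v uv y) (x≢y ∘ ψ-injective u v uv) (ψ.image-path u v uv (ψ-injective u v uv) P))
      fitsH : Fits lH E
      fitsH x y x≢y P with core? x | core? y
      ... | yes (inj₁ refl) | yes (inj₁ refl) = contradiction refl x≢y
      ... | yes (inj₁ refl) | yes (inj₂ refl) = short adjacent P
      ... | yes (inj₂ refl) | yes (inj₁ refl) = short (symH adjacent) P
      ... | yes (inj₂ refl) | yes (inj₂ refl) = contradiction refl x≢y
      ... | no ¬c           | _               = off-core x≢y (¬c ∘ proj₁) P
      ... | yes _           | no ¬c           = off-core x≢y (¬c ∘ proj₂) P
    -- Pulled back to the gadget, the two labels of the tree edge become those of `(v₁ , v₂)` and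
    -- `(v₂ , v₁)`. The pulled-back labeling respects `E`, so `enforces` applies.
    symmetric-label : ∀ u v (e : Adj u v) → l u v e ≡ l v u (symmetric e)
    symmetric-label u v e = begin
      l′ (ι u) (ι v) (ι-edge {u} {v} e)                         ≡⟨ lab-cong {G = G′} l′ (cong number (sym (φ-v₁ u v))) (cong number (sym (φ-v₂ u v))) (ι-edge {u} {v} e) (ψ-hom u v e {v₁} {v₂} adjacent) ⟩
      lH u v e v₁ v₂ adjacent                                   ≡⟨ enforces (lH u v e) (fits⇒respects (lH u v e) treeH (fitsH u v e)) ⟩
      lH u v e v₂ v₁ (symH adjacent)                            ≡⟨ lab-cong {G = G′} l′ (cong number (φ-v₂ u v)) (cong number (φ-v₁ u v)) (ψ-hom u v e {v₂} {v₁} (symH adjacent)) (ι-edge {v} {u} (symmetric e)) ⟩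
      l′ (ι v) (ι u) (ι-edge {v} {u} (symmetric e))             ∎
      where open ≡-Reasoning

  -- From an undirected labeling to a labeling of the glued tree

  module Forwards (0<Δ : 0 < Δ) (λG : Labeling Δ G) (respG : Respects G (Labeling.label λG) D) where

    private
      instance
        Δ≢0 : NonZero Δ
        Δ≢0 = >-nonZero 0<Δ

    l : DiLabeling Δ G
    l = Labeling.label λG

    lH : DiLabeling Δ H
    lH = proj₁ realizable

    c′ : ℕ
    c′ = toℕ (lH v₁ v₂ adjacent)

    tG : Fin n → Fin n → Fin Δ
    tG = total {G = G} 0<Δ l

    tH : Fin m → Fin m → Fin Δ
    tH = total {G = H} 0<Δ lH

    -- The labels of the copy for (u , v) are shifted so that the copy of (v₁ , v₂) has the label of (u , v).
    rotate : (u v : Fin n) → Fin Δ → Fin Δ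
    rotate u v a = fromℕ< (m%n<n (toℕ a + toℕ (tG u v) + (Δ ∸ c′)) Δ)

    -- Subtracting `c′` is done by adding `Δ ∸ c′`, which accounts for the one period on the left;
    -- the quotient `x / Δ` on the right restores what the remainder removed.
    rotate-shifted : ∀ u v a → Shifted (toℕ (tG u v)) c′ (toℕ a) (toℕ (rotate u v a))
    rotate-shifted u v a = shift 1 (x / Δ) (begin
      toℕ a + c + 1 * Δ                   ≡⟨ cong (toℕ a + c +_) (trans (*-identityˡ Δ) (sym (m∸n+n≡m (<⇒≤ (toℕ<n (lH v₁ v₂ adjacent)))))) ⟩
      toℕ a + c + (Δ ∸ c′ + c′)           ≡⟨ +-assoc (toℕ a + c) (Δ ∸ c′) c′ ⟨
      x + c′                              ≡⟨ cong (_+ c′) (m≡m%n+[m/n]*n x Δ) ⟩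
      x % Δ + (x / Δ) * Δ + c′            ≡⟨ trans (+-assoc (x % Δ) _ c′) (trans (cong (x % Δ +_) (+-comm _ c′)) (sym (+-assoc (x % Δ) c′ _))) ⟩
      x % Δ + c′ + (x / Δ) * Δ            ≡⟨ cong (λ y → y + c′ + (x / Δ) * Δ) (toℕ-fromℕ< (m%n<n x Δ)) ⟨
      toℕ (rotate u v a) + c′ + (x / Δ) * Δ ∎)
      where
      open ≡-Reasoning
      c = toℕ (tG u v)
      x = toℕ a + c + (Δ ∸ c′)

    -- The gadget vertex for which the tree vertex at the other end of the edge stands. The value at
    -- `far` is arbitrary, there being no such edge.
    side : Link → Fin m
    side side₁ = v₁
    side side₂ = v₂
    side far   = v₁

    L : V → V → Fin Δ
    L (base a)    (base b)    = tG a b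
    L (base w)    (new u v y) = rotate u v (tH (side (link y)) y)
    L (new u v x) (base w)    = rotate u v (tH x (side (link x)))
    L (new u v x) (new _ _ y) = rotate u v (tH x y)

    l′ : DiLabeling Δ G′
    l′ i j _ = L (vertex i) (vertex j)

    L-number : ∀ r s {e : Graph.Adj G′ (number r) (number s)} → l′ (number r) (number s) e ≡ L r s
    L-number r s = cong₂ L (vertex-number r) (vertex-number s)

    l-shifted : ∀ {a b} (e : Adj a b) → Shifted 0 0 (toℕ (l a b e)) (toℕ (l′ (ι a) (ι b) (ι-edge {a} {b} e)))
    l-shifted {a} {b} e = subst (Shifted 0 0 (toℕ (l a b e)) ∘ toℕ)
      (sym (trans (L-number (base a) (base b) {ι-edge {a} {b} e}) (total-edge {G = G} 0<Δ l e))) unshifted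

    module _ {u v : Fin n} (uv : Adj u v) where

      c : ℕ
      c = toℕ (tG u v)

      swapped : tG v u ≡ tG u v
      swapped = trans (total-edge {G = G} 0<Δ l (symmetric uv)) (trans (sym (Labeling.unoriented λG u v uv)) (sym (total-edge {G = G} 0<Δ l uv)))

      -- All edges touching a non-core copy are rotated by definition. On the tree edge itself
      -- nothing is rotated: the gadget's label is `c′` in both directions by `enforces`, the tree's
      -- label is `c` in both by `swapped`, and `c′ + c` equals `c + c′`.
      tH-shifted : ∀ {x y} → AdjH x y → Shifted c c′ (toℕ (tH x y)) (toℕ (L (φ u v x) (φ u v y)))
      tH-shifted {x} {y} a with φ u v x | φ-view u v x | φ u v y | φ-view u v y
      ... | _ | is-v₁    | _ | is-v₁     = contradiction a irrH
      ... | _ | is-v₁    | _ | is-v₂     = shift 0 0 (cong (_+ 0)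
        (trans (cong (λ t → toℕ t + c) (total-edge {G = H} 0<Δ lH adjacent)) (+-comm c′ c)))
      ... | _ | is-v₂    | _ | is-v₁     = shift 0 0 (cong (_+ 0)
        (trans (cong (λ t → toℕ t + c) (trans (total-edge {G = H} 0<Δ lH (symH adjacent)) (sym (enforces lH (proj₂ realizable)))))
          (trans (+-comm c′ c) (cong (λ t → toℕ t + c′) (sym swapped)))))
      ... | _ | is-v₂    | _ | is-v₂     = contradiction a irrH
      ... | _ | is-v₁    | _ | other ¬c  rewrite link-near₁ ¬c (symH a) = rotate-shifted u v (tH v₁ y)
      ... | _ | is-v₂    | _ | other ¬c  rewrite link-near₂ ¬c (symH a) = rotate-shifted u v (tH v₂ y)
      ... | _ | other ¬c | _ | is-v₁     rewrite link-near₁ ¬c a = rotate-shifted u v (tH x v₁)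
      ... | _ | other ¬c | _ | is-v₂     rewrite link-near₂ ¬c a = rotate-shifted u v (tH x v₂)
      ... | _ | other ¬c | _ | other ¬c′ = rotate-shifted u v (tH x y)

      lH-shifted : ∀ {x y} (e : AdjH x y) →
        Shifted c c′ (toℕ (lH x y e)) (toℕ (l′ (ψ u v uv x) (ψ u v uv y) (ψ-hom u v uv {x} {y} e)))
      lH-shifted {x} {y} e = subst₂ (λ a b → Shifted c c′ (toℕ a) (toℕ b))
        (total-edge {G = H} 0<Δ lH e) (sym (L-number (φ u v x) (φ u v y) {ψ-hom u v uv {x} {y} e})) (tH-shifted e)

    fits : Fits l D
    fits = respects⇒fits l isTree respG

    fitsH : Fits lH E
    fitsH = respects⇒fits lH treeH (proj₂ realizable)

    fits′ : Fits l′ D′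
    fits′ = by-vertices (λ i j b → i ≢ j → (P : Path G′ i j) → fin (cost l′ (Path.walk P)) ≤⁺ b) λ r s → fitsV (bound-view r s)
      where
      fitsV : ∀ {r s b} → Bound r s b → number r ≢ number s → (P : Path G′ (number r) (number s)) → fin (cost l′ (Path.walk P)) ≤⁺ b
      fitsV unbounded _ _ = _ ≤⊤⁺
      fitsV (old a b) a≢b P = subst (λ x → fin x ≤⁺ D a b)
        (trans (sym (ι.cost-image l l′ l-shifted (Path.walk Q))) (cong (cost l′) (same-path G′-tree (ι.image-path (λ {a} {b} → ι-injective {a} {b}) Q) P)))
        (fits a b (a≢b ∘ cong ι) Q)
        where Q = IsTree.connected isTree a b
      fitsV (gadget {u} {v} uv x y) x≢y P = subst (λ z → fin z ≤⁺ E x y)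
        (trans (sym (ψ.cost-image u v uv lH l′ (lH-shifted uv) (Path.walk Q))) (cong (cost l′) (same-path G′-tree (ψ.image-path u v uv (ψ-injective u v uv) Q) P)))
        (fitsH x y (x≢y ∘ cong (ψ u v uv)) Q)
        where Q = IsTree.connected treeH x y

    forwards : DiRealizable Δ reduced
    forwards = l′ , fits⇒respects l′ G′-tree fits′

  equivalent : 0 < Δ → Realizable Δ I ⇔ DiRealizable Δ reduced
  equivalent 0<Δ = mk⇔ (λ (l , resp) → Forwards.forwards 0<Δ l resp) backwards

-- Stack programs

private variable
  s k : ℕ

-- The base is `suc n` so that powers are at least 1 and exponents may be raised when bounds are
-- combined.
Poly : (ℕ → ℕ) → Set
Poly f = Σ[ c ∈ ℕ ] Σ[ d ∈ ℕ ] (∀ n → f n ≤ c * suc n ^ d)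

poly-const : ∀ c → Poly (λ _ → c)
poly-const c = c , 0 , λ n → ≤-reflexive (sym (*-identityʳ c))

poly-id : Poly id
poly-id = 1 , 1 , λ n → ≤-trans (n≤1+n n) (≤-reflexive (sym (trans (*-identityˡ _) (*-identityʳ (suc n)))))

poly-+ : ∀ {f g} → Poly f → Poly g → Poly (λ n → f n + g n)
poly-+ (c , d , p) (c′ , d′ , q) = c + c′ , d + d′ , λ n → ≤-trans
  (+-mono-≤ (≤-trans (p n) (*-monoʳ-≤ c (^-monoʳ-≤ (suc n) (m≤m+n d d′))))
            (≤-trans (q n) (*-monoʳ-≤ c′ (^-monoʳ-≤ (suc n) (m≤n+m d′ d)))))
  (≤-reflexive (sym (*-distribʳ-+ (suc n ^ (d + d′)) c c′)))

poly-* : ∀ {f g} → Poly f → Poly g → Poly (λ n → f n * g n)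
poly-* (c , d , p) (c′ , d′ , q) = c * c′ , d + d′ , λ n → ≤-trans
  (*-mono-≤ (p n) (q n))
  (≤-reflexive (trans ([m*n]*[o*p]≡[m*o]*[n*p] c (suc n ^ d) c′ (suc n ^ d′))
                      (cong (c * c′ *_) (sym (^-distribˡ-+-* (suc n) d d′)))))

^-distribʳ-* : ∀ d m n → (m * n) ^ d ≡ m ^ d * n ^ d
^-distribʳ-* zero    m n = refl
^-distribʳ-* (suc d) m n = trans (cong (m * n *_) (^-distribʳ-* d m n)) ([m*n]*[o*p]≡[m*o]*[n*p] m n (m ^ d) (n ^ d))

-- For positive `n`, `suc n` is at most `2 * n`; the summand `2 ^ d` covers `n = 0`.
suc-^-≤ : ∀ n d → suc n ^ d ≤ 2 ^ d * n ^ d + 2 ^ d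
suc-^-≤ zero d rewrite ^-zeroˡ d = ≤-trans (m^n>0 2 d) (m≤n+m (2 ^ d) (2 ^ d * 0 ^ d))
suc-^-≤ n@(suc m) d = ≤-trans (^-monoˡ-≤ d (+-mono-≤ (s≤s (z≤n {m})) (m≤m+n n 0)))
  (≤-trans (≤-reflexive (^-distribʳ-* d 2 n)) (m≤m+n _ (2 ^ d)))

infix 4 _⊢_⟶[_]_

-- An upper bound in place of the exact number of steps, so that different runs of a loop body can
-- share one bound.
_⊢_⟶[_]_ : Program s → Store s → ℕ → Store s → Set
p ⊢ σ ⟶[ b ] τ = Σ[ t ∈ ℕ ] (p ⊢ σ ⇓[ t ] τ) × t ≤ b

module _ {p : Program s} where

  within : ∀ {σ τ b b′} → b ≤ b′ → p ⊢ σ ⟶[ b ] τ → p ⊢ σ ⟶[ b′ ] τ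
  within b≤b′ (t , run , t≤b) = t , run , ≤-trans t≤b b≤b′

  to : ∀ {σ τ τ′ b} → τ ≡ τ′ → p ⊢ σ ⟶[ b ] τ → p ⊢ σ ⟶[ b ] τ′
  to refl run = run

  from : ∀ {σ σ′ τ b} → σ ≡ σ′ → p ⊢ σ′ ⟶[ b ] τ → p ⊢ σ ⟶[ b ] τ
  from refl run = run

infixr 5 _⨾_

_⨾_ : ∀ {p q : Program s} {σ τ ρ b b′} → p ⊢ σ ⟶[ b ] τ → q ⊢ τ ⟶[ b′ ] ρ → p ⨟ q ⊢ σ ⟶[ b + b′ ] ρ
(_ , r , l) ⨾ (_ , r′ , l′) = _ , seq r r′ , +-mono-≤ l l′

pushing : ∀ {i a} {σ : Store s} → push i a ⊢ σ ⟶[ 1 ] σ [ i ]≔ (a ∷ lookup σ i)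
pushing = 1 , push , ≤-refl

popping : ∀ {i} {σ : Store s} → pop i ⊢ σ ⟶[ 1 ] σ [ i ]≔ List.drop 1 (lookup σ i)
popping = 1 , pop , ≤-refl

skipping : {σ : Store s} → skip ⊢ σ ⟶[ 1 ] σ
skipping = 1 , skip , ≤-refl

switching : ∀ {i f} {σ τ : Store s} {b} → f (top i σ) ⊢ σ ⟶[ b ] τ → switch i f ⊢ σ ⟶[ suc b ] τ
switching (_ , r , l) = _ , switch r , s≤s l

-- The time of a `while` loop with `k` rounds of at most `b` steps each, with one step per test
-- including the failing one.
rounds : ℕ → ℕ → ℕ
rounds b zero    = 1
rounds b (suc k) = suc (b + rounds b k)

rounds≡ : ∀ b k → rounds b k ≡ 1 + k * suc b
rounds≡ b zero    = refl
rounds≡ b (suc k) = cong suc (trans (cong (b +_) (rounds≡ b k)) (+-suc b (k * suc b)))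

rounds-mono : ∀ b {k l} → k ≤ l → rounds b k ≤ rounds b l
rounds-mono b {k} {l} k≤l rewrite rounds≡ b k | rounds≡ b l = s≤s (*-monoˡ-≤ (suc b) k≤l)

poly-rounds : ∀ {f g} → Poly f → Poly g → Poly (λ n → rounds (f n) (g n))
poly-rounds {f} {g} F G with poly-+ (poly-const 1) (poly-* G (poly-+ (poly-const 1) F))
... | c , d , p = c , d , λ n → subst (_≤ c * suc n ^ d) (sym (rounds≡ (f n) (g n))) (p n)

stopping : ∀ {i c} {p : Program s} {σ} → c (top i σ) ≡ false → while i c p ⊢ σ ⟶[ 1 ] σ
stopping e = 1 , stop e , ≤-refl

looping : ∀ {i c} {p : Program s} {σ τ ρ b b′} → c (top i σ) ≡ true →
          p ⊢ σ ⟶[ b ] τ → while i c p ⊢ τ ⟶[ b′ ] ρ → while i c p ⊢ σ ⟶[ suc (b + b′) ] ρ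
looping e (_ , r , l) (_ , r′ , l′) = _ , loop e r r′ , s≤s (+-mono-≤ l l′)

move : Fin s → Fin s → Program s
move i j = switch i λ { nothing → skip ; (just a) → pop i ⨟ push j a }

drain : Fin s → Program s → Program s
drain i p = while i is-just p

unary : ℕ → Word
unary n = List.replicate n 𝟙

unary-ʳ++ : ∀ m n → unary m ʳ++ unary n ≡ unary (m + n)
unary-ʳ++ zero    n = refl
unary-ʳ++ (suc m) n = trans (unary-ʳ++ m (suc n)) (cong unary (+-suc m n))

unary-ʳ++-[] : ∀ m → unary m ʳ++ [] ≡ unary m
unary-ʳ++-[] m = trans (unary-ʳ++ m 0) (cong unary (+-identityʳ m))

module _ (δ : Symbol → Bool) where

  after : Word → Word
  after []      = []
  after (a ∷ r) = if δ a then r else after r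

  passed : Word → Word → Word
  passed []      q = q
  passed (a ∷ r) q = if δ a then a ∷ q else passed r (a ∷ q)

  -- Moving the head loses nothing: the part read, kept reversed, and the part ahead still make up
  -- the input. Rewinding relies on this.
  passed-after : ∀ r q → passed r q ʳ++ after r ≡ q ʳ++ r
  passed-after []      q = refl
  passed-after (a ∷ r) q with δ a
  ... | true  = refl
  ... | false = passed-after r (a ∷ q)

  afters : ℕ → Word → Word
  afters zero    r = r
  afters (suc k) r = afters k (after r)

  upTo : Word → Word
  upTo []      = []
  upTo (a ∷ r) = if δ a then [] else a ∷ upTo r

  from-first : Word → Word
  from-first []      = []
  from-first (a ∷ r) = if δ a then a ∷ r else from-first r

  upTo-from-first : ∀ r q → (upTo r ʳ++ q) ʳ++ from-first r ≡ q ʳ++ r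
  upTo-from-first []      q = refl
  upTo-from-first (a ∷ r) q with δ a
  ... | true  = refl
  ... | false = upTo-from-first r (a ∷ q)

  until : Maybe Symbol → Bool
  until nothing  = false
  until (just a) = not (δ a)

  Free : Word → Set
  Free = All (λ a → δ a ≡ false)

  after-++ : ∀ {p} → Free p → ∀ {c r} → δ c ≡ true → after (p ++ c ∷ r) ≡ r
  after-++ []      e rewrite e = refl
  after-++ (f ∷ fs) e rewrite f = after-++ fs e

  upTo-++ : ∀ {p} → Free p → ∀ {c r} → δ c ≡ true → upTo (p ++ c ∷ r) ≡ p
  upTo-++ []      e rewrite e = refl
  upTo-++ (f ∷ fs) e rewrite f = cong (_ ∷_) (upTo-++ fs e)

  -- The only delimiter in a block is its terminator, so skipping `i` delimiters skips exactly `i`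
  -- blocks.
  afters-blocks : ∀ {c} → δ c ≡ true → ∀ {n} (g : Fin n → Word) → (∀ u → Free (g u)) → ∀ i r →
    ∃[ r′ ] afters (toℕ i) (concat (tabulate λ u → g u ++ [ c ]) ++ r) ≡ g i ++ c ∷ r′
  afters-blocks {c} e {suc n} g free i r
    rewrite ++-assoc (g zero ++ [ c ]) (concat (tabulate (λ u → g (suc u) ++ [ c ]))) r
          | ++-assoc (g zero) [ c ] (concat (tabulate (λ u → g (suc u) ++ [ c ])) ++ r) with i
  ... | zero   = _ , refl
  ... | suc i′ rewrite after-++ (free zero) {c} {concat (tabulate (λ u → g (suc u) ++ [ c ])) ++ r} e
    = afters-blocks e (g ∘ suc) (free ∘ suc) i′ r

comma? semicolon? bar? : Symbol → Bool
comma? comma = true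
comma? _     = false
semicolon? semicolon = true
semicolon? _         = false
bar? bar = true
bar? _   = false

-- Stack routines and a small loop language for printing

module Machine (K : ℕ) where

  Prog : Set
  Prog = Program (7 + K)

  -- SIZE holds the number of vertices and var x the loop variable x, both in unary;
  -- TMP, A and B are empty between the phases.
  OUT IN PASSED SIZE TMP A B : Fin (7 + K)
  OUT    = zero
  IN     = suc zero
  PASSED = suc (suc zero)
  SIZE   = suc (suc (suc zero))
  TMP    = suc (suc (suc (suc zero)))
  A      = suc (suc (suc (suc (suc zero))))
  B      = suc (suc (suc (suc (suc (suc zero)))))

  var : Fin K → Fin (7 + K)
  var x = 7 ↑ʳ x

  pattern ⟨_,_,_,_,_,_,_,_⟩ o r q n t a b vs = o ∷ r ∷ q ∷ n ∷ t ∷ a ∷ b ∷ vs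

  top-var : ∀ (vs : Vec Word K) x w → is-just (List.head (lookup (vs [ x ]≔ w) x)) ≡ is-just (List.head w)
  top-var vs x w rewrite lookup∘update x vs w = refl

  module _ {o r q n b : Word} where

    private
      at : Word → Word → Vec Word K → Store (7 + K)
      at t a vs = ⟨ o , r , q , n , t , a , b , vs ⟩

    pop-var : ∀ {t a vs x c w} → pop (var x) ⊢ at t a (vs [ x ]≔ (c ∷ w)) ⟶[ 1 ] at t a (vs [ x ]≔ w)
    pop-var {t} {a} {vs} {x} {c} {w} = to
      (cong (at t a) (trans (cong (λ l → vs [ x ]≔ (c ∷ w) [ x ]≔ List.drop 1 l) (lookup∘update x vs _)) ([]≔-idempotent vs x)))
      popping

    push-var : ∀ {t a vs x c w} → push (var x) c ⊢ at t a (vs [ x ]≔ w) ⟶[ 1 ] at t a (vs [ x ]≔ (c ∷ w))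
    push-var {t} {a} {vs} {x} {c} {w} = to
      (cong (at t a) (trans (cong (λ l → vs [ x ]≔ w [ x ]≔ (c ∷ l)) (lookup∘update x vs _)) ([]≔-idempotent vs x)))
      pushing

  restore-var : Fin K → Prog
  restore-var x = drain TMP (pop TMP ⨟ push (var x) 𝟙)

  restoring-var : ∀ {o r q n a b vs x} k w →
    restore-var x ⊢ ⟨ o , r , q , n , unary k , a , b , vs [ x ]≔ w ⟩
      ⟶[ rounds 2 k ] ⟨ o , r , q , n , [] , a , b , vs [ x ]≔ (unary k ʳ++ w) ⟩
  restoring-var zero    w = stopping refl
  restoring-var {vs = vs} {x} (suc k) w = looping refl (popping ⨾ push-var {vs = vs}) (restoring-var k (𝟙 ∷ w))

  -- Reading a stack deeper than its top destroys it, so the value is poured into `TMP` as well and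
  -- restored from there.
  copy-var : Fin K → Fin (7 + K) → Prog
  copy-var x i = drain (var x) (pop (var x) ⨟ push TMP 𝟙 ⨟ push i 𝟙) ⨟ restore-var x

  copy-cost : ℕ → ℕ
  copy-cost k = rounds 3 k + rounds 2 k

  module _ {o r q n : Word} {vs : Vec Word K} {x : Fin K} where

    private
      scanA : ∀ {b} k {t a} →
        drain (var x) (pop (var x) ⨟ push TMP 𝟙 ⨟ push A 𝟙) ⊢ ⟨ o , r , q , n , t , a , b , vs [ x ]≔ unary k ⟩
          ⟶[ rounds 3 k ] ⟨ o , r , q , n , unary k ʳ++ t , unary k ʳ++ a , b , vs [ x ]≔ [] ⟩
      scanA zero    = stopping (top-var vs x [])
      scanA (suc k) = looping (top-var vs x (unary (suc k))) (pop-var {vs = vs} ⨾ pushing ⨾ pushing) (scanA k)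

      scanB : ∀ {a} k {t b} →
        drain (var x) (pop (var x) ⨟ push TMP 𝟙 ⨟ push B 𝟙) ⊢ ⟨ o , r , q , n , t , a , b , vs [ x ]≔ unary k ⟩
          ⟶[ rounds 3 k ] ⟨ o , r , q , n , unary k ʳ++ t , a , unary k ʳ++ b , vs [ x ]≔ [] ⟩
      scanB zero    = stopping (top-var vs x [])
      scanB (suc k) = looping (top-var vs x (unary (suc k))) (pop-var {vs = vs} ⨾ pushing ⨾ pushing) (scanB k)

      same : ∀ {k} → lookup vs x ≡ unary k → vs ≡ vs [ x ]≔ unary k
      same e = trans (sym ([]≔-lookup vs x)) (cong (vs [ x ]≔_) e)

    copying-A : ∀ {b k} → lookup vs x ≡ unary k →
      copy-var x A ⊢ ⟨ o , r , q , n , [] , [] , b , vs ⟩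
        ⟶[ copy-cost k ] ⟨ o , r , q , n , [] , unary k , b , vs ⟩
    copying-A {b} {k} e =
      from (cong ⟨ o , r , q , n , [] , [] , b ,_⟩ (same e))
      (to (cong₂ ⟨ o , r , q , n , [] ,_, b ,_⟩ (unary-ʳ++-[] k)
             (trans (cong (vs [ x ]≔_) (unary-ʳ++-[] k)) (sym (same e))))
      (scanA k ⨾ from (cong ⟨ o , r , q , n ,_, unary k ʳ++ [] , b , vs [ x ]≔ [] ⟩ (unary-ʳ++-[] k))
                      (restoring-var k [])))

    copying-B : ∀ {a k} → lookup vs x ≡ unary k →
      copy-var x B ⊢ ⟨ o , r , q , n , [] , a , [] , vs ⟩
        ⟶[ copy-cost k ] ⟨ o , r , q , n , [] , a , unary k , vs ⟩
    copying-B {a} {k} e =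
      from (cong ⟨ o , r , q , n , [] , a , [] ,_⟩ (same e))
      (to (cong₂ ⟨ o , r , q , n , [] , a ,_,_⟩ (unary-ʳ++-[] k)
             (trans (cong (vs [ x ]≔_) (unary-ʳ++-[] k)) (sym (same e))))
      (scanB k ⨾ from (cong ⟨ o , r , q , n ,_, a , unary k ʳ++ [] , vs [ x ]≔ [] ⟩ (unary-ʳ++-[] k))
                      (restoring-var k [])))

  step : Prog
  step = move IN PASSED

  -- The loop stops in front of the delimiter; the extra `step` passes it, and does nothing at the
  -- end of the input.
  skip-past : (Symbol → Bool) → Prog
  skip-past δ = while IN (until δ) step ⨟ step

  skip-cost : ℕ → ℕ
  skip-cost l = rounds 3 l + 3

  module _ {o n t a b : Word} {vs : Vec Word K} where

    private
      st : Word → Word → Store (7 + K)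
      st r q = ⟨ o , r , q , n , t , a , b , vs ⟩

    skipping-past : ∀ δ r q → skip-past δ ⊢ st r q ⟶[ skip-cost (length r) ] st (after δ r) (passed δ r q)
    skipping-past δ []      q = stopping refl ⨾ within (s≤s (s≤s z≤n)) (switching skipping)
    skipping-past δ (c ∷ r) q with δ c in e
    ... | true  = within (s≤s (m≤n+m 3 (3 + rounds 3 (length r)))) (stopping (cong not e) ⨾ switching (popping ⨾ pushing))
    -- The new round belongs to the `while` inside the sequence, so the run for the shorter input is
    -- taken apart and reassembled.
    ... | false with skipping-past δ r (c ∷ q)
    ... | _ , seq {t = u} {t′ = u′} run run′ , bound =
      _ , seq (loop (cong not e) (switch (seq pop push)) run) run′ , +-monoʳ-≤ 4 bound

    rewinding : ∀ r q → drain PASSED (move PASSED IN) ⊢ st r q ⟶[ rounds 3 (length q) ] st (q ʳ++ r) []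
    rewinding r []      = stopping refl
    rewinding r (c ∷ q) = looping refl (switching (popping ⨾ pushing)) (rewinding (c ∷ r) q)

  rewind : Prog
  rewind = drain PASSED (move PASSED IN)

  -- Each symbol goes to `PASSED` for the later rewinding and to `TMP` for the output; `flush`
  -- undoes the reversal in `TMP`.
  read-upto-comma : Prog
  read-upto-comma = while IN (until comma?) (switch IN λ { nothing → skip ; (just a) → pop IN ⨟ push PASSED a ⨟ push TMP a })

  flush : Prog
  flush = drain TMP (move TMP OUT)

  reading-upto-comma : ∀ {o n a b vs} r q t →
    read-upto-comma ⊢ ⟨ o , r , q , n , t , a , b , vs ⟩
      ⟶[ rounds 4 (length r) ] ⟨ o , from-first comma? r , upTo comma? r ʳ++ q , n , upTo comma? r ʳ++ t , a , b , vs ⟩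
  reading-upto-comma []      q t = stopping refl
  reading-upto-comma (c ∷ r) q t with comma? c in e
  ... | true  = within (s≤s z≤n) (stopping (cong not e))
  ... | false = looping (cong not e) (switching (popping ⨾ pushing ⨾ pushing)) (reading-upto-comma r (c ∷ q) (c ∷ t))

  flushing : ∀ {r q n a b vs} t o →
    flush ⊢ ⟨ o , r , q , n , t , a , b , vs ⟩ ⟶[ rounds 3 (length t) ] ⟨ t ʳ++ o , r , q , n , [] , a , b , vs ⟩
  flushing []      o = stopping refl
  flushing (c ∷ t) o = looping refl (switching (popping ⨾ pushing)) (flushing t (c ∷ o))

  -- PASSED holds the part q of the input w before the reading head, reversed, and IN the rest r.
  module _ {w : Word} {r q : Word} (qr : q ʳ++ r ≡ w) where

    ahead≤ : length r ≤ length w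
    ahead≤ = subst (length r ≤_) (trans (sym (length-ʳ++ q)) (cong length qr)) (m≤n+m (length r) (length q))

    behind≤ : length q ≤ length w
    behind≤ = subst (length q ≤_) (trans (sym (length-ʳ++ q)) (cong length qr)) (m≤m+n (length q) (length r))

  skip-many : (Symbol → Bool) → Prog
  skip-many δ = drain A (pop A ⨟ skip-past δ)

  skipping-many : ∀ {o n t b vs w} δ k {r q} → q ʳ++ r ≡ w →
    ∃[ q′ ] (q′ ʳ++ afters δ k r ≡ w) ×
      (skip-many δ ⊢ ⟨ o , r , q , n , t , unary k , b , vs ⟩
         ⟶[ rounds (1 + skip-cost (length w)) k ] ⟨ o , afters δ k r , q′ , n , t , [] , b , vs ⟩)
  skipping-many δ zero    {r} {q} qr = q , qr , stopping refl
  skipping-many {w = w} δ (suc k) {r} {q} qr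
    with skipping-many δ k (trans (passed-after δ r q) qr)
  ... | q′ , qr′ , run = q′ , qr′ ,
    looping refl (popping ⨾ within (+-monoˡ-≤ 3 (rounds-mono 3 (ahead≤ {w} {r} {q} qr))) (skipping-past δ r q)) run

  data Section : Set where
    first second : Section

  enter : Section → Prog
  enter first  = skip
  enter second = skip-past bar?

  entered : Section → Word → Word
  entered first  w = w
  entered second w = after bar? w

  -- Within its section an entry sits behind as many semicolons as its row index and then as many
  -- commas as its column index. The indices are copied to `A` because `skip-many` consumes its
  -- counter.
  seek : Section → Fin K → Fin K → Prog
  seek m x y = enter m ⨟ copy-var x A ⨟ skip-many semicolon? ⨟ copy-var y A ⨟ skip-many comma?

  sought : Section → ℕ → ℕ → Word → Word
  sought m i j w = afters comma? j (afters semicolon? i (entered m w))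

  walk-cost seek-cost : ℕ → ℕ
  walk-cost l = rounds (1 + skip-cost l) l
  seek-cost l = skip-cost l + (copy-cost l + (walk-cost l + (copy-cost l + walk-cost l)))

  copy-cost-mono : ∀ {k l} → k ≤ l → copy-cost k ≤ copy-cost l
  copy-cost-mono k≤l = +-mono-≤ (rounds-mono 3 k≤l) (rounds-mono 2 k≤l)

  entering : ∀ {o n t a b vs w} m →
    ∃[ q ] (q ʳ++ entered m w ≡ w) ×
      (enter m ⊢ ⟨ o , w , [] , n , t , a , b , vs ⟩
         ⟶[ skip-cost (length w) ] ⟨ o , entered m w , q , n , t , a , b , vs ⟩)
  entering {w = w} first  = [] , refl , within (≤-trans (s≤s z≤n) (m≤n+m 3 _)) skipping
  entering {w = w} second = _ , passed-after bar? w [] , skipping-past bar? w []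

  seeking : ∀ {o n b vs w} m {x y i j} → lookup vs x ≡ unary i → lookup vs y ≡ unary j →
    i ≤ length w → j ≤ length w →
    ∃[ q ] (q ʳ++ sought m i j w ≡ w) ×
      (seek m x y ⊢ ⟨ o , w , [] , n , [] , [] , b , vs ⟩
         ⟶[ seek-cost (length w) ] ⟨ o , sought m i j w , q , n , [] , [] , b , vs ⟩)
  seeking {w = w} m {i = i} {j} ex ey i≤ j≤
    with q₀ , e₀ , run₀ ← entering {w = w} m
    with q₁ , e₁ , run₁ ← skipping-many semicolon? i e₀
    with q₂ , e₂ , run₂ ← skipping-many comma? j e₁
    = q₂ , e₂ , (run₀ ⨾ within (copy-cost-mono i≤) (copying-A ex) ⨾ within (rounds-mono _ i≤) run₁
                      ⨾ within (copy-cost-mono j≤) (copying-A ey) ⨾ within (rounds-mono _ j≤) run₂)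

  print : Section → Fin K → Fin K → Prog
  print m x y = seek m x y ⨟ read-upto-comma ⨟ flush ⨟ rewind

  print-cost : ℕ → ℕ
  print-cost l = seek-cost l + (rounds 4 l + (rounds 3 l + rounds 3 l))

  printing : ∀ {o n b vs w} m {x y i j} → lookup vs x ≡ unary i → lookup vs y ≡ unary j →
    i ≤ length w → j ≤ length w →
    print m x y ⊢ ⟨ o , w , [] , n , [] , [] , b , vs ⟩
      ⟶[ print-cost (length w) ] ⟨ upTo comma? (sought m i j w) ++ o , w , [] , n , [] , [] , b , vs ⟩
  printing {o} {n} {b} {vs} {w} m {i = i} {j} ex ey i≤ j≤
    with q , e , run ← seeking m ex ey i≤ j≤
    = to (cong₂ ⟨_,_, [] , n , [] , [] , b , vs ⟩ (ʳ++-ʳ++ u) (trans (upTo-from-first comma? r q) e))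
      (run ⨾ within (rounds-mono 4 (ahead≤ {w} {r} {q} e)) (reading-upto-comma r q [])
           ⨾ within (rounds-mono 3 u≤) (flushing (u ʳ++ []) o)
           ⨾ within (rounds-mono 3 (behind≤ {w} {from-first comma? r} {u ʳ++ q} (trans (upTo-from-first comma? r q) e)))
                    (rewinding (from-first comma? r) (u ʳ++ q)))
    where
    r = sought m i j w
    u = upTo comma? r
    u≤ : length (u ʳ++ []) ≤ length w
    u≤ = ≤-trans (≤-reflexive (trans (length-ʳ++ u) (+-identityʳ _)))
         (≤-trans (m≤m+n (length u) (length q))
         (≤-trans (≤-reflexive (sym (length-ʳ++ u)))
                  (behind≤ {w} {from-first comma? r} {u ʳ++ q} (trans (upTo-from-first comma? r q) e))))

  is-one : Maybe Symbol → Bool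
  is-one (just 𝟙) = true
  is-one _        = false

  -- The bit is visible only while the head is on the entry, so each branch rewinds for itself after
  -- the decision.
  test-bit : Fin K → Fin K → Prog → Prog → Prog
  test-bit x y p p′ = seek first x y ⨟ switch IN λ c → if is-one c then rewind ⨟ p else rewind ⨟ p′

  fork : ∀ {σ τ ρ : Store (7 + K)} {b c p q q′} β → p ⊢ σ ⟶[ b ] τ → (if β then q else q′) ⊢ τ ⟶[ c ] ρ →
    (if β then p ⨟ q else p ⨟ q′) ⊢ σ ⟶[ b + c ] ρ
  fork true  = _⨾_
  fork false = _⨾_

  testing-bit : ∀ {o n b vs w τ c} {x y i j p p′} → lookup vs x ≡ unary i → lookup vs y ≡ unary j →
    i ≤ length w → j ≤ length w →
    (if is-one (List.head (sought first i j w)) then p else p′) ⊢ ⟨ o , w , [] , n , [] , [] , b , vs ⟩ ⟶[ c ] τ →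
    test-bit x y p p′ ⊢ ⟨ o , w , [] , n , [] , [] , b , vs ⟩
      ⟶[ seek-cost (length w) + (1 + (rounds 3 (length w) + c)) ] τ
  testing-bit {o} {n} {b} {vs} {w} {τ} {c} {i = i} {j} {p} {p′} ex ey i≤ j≤ run′
    with q , e , run ← seeking first ex ey i≤ j≤
    = run ⨾ switching (fork (is-one (List.head (sought first i j w))) back run′)
    where
    back : rewind ⊢ ⟨ o , sought first i j w , q , n , [] , [] , b , vs ⟩ ⟶[ rounds 3 (length w) ] ⟨ o , w , [] , n , [] , [] , b , vs ⟩
    back = within (rounds-mono 3 (behind≤ {w} {sought first i j w} {q} e))
           (to (cong ⟨ o ,_, [] , n , [] , [] , b , vs ⟩ e) (rewinding (sought first i j w) q))

  -- Cancels two unary numbers against each other; `A` and `TMP` keep the two truncated differences,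
  -- and both end up empty exactly for equal numbers.
  subtract : Prog
  subtract = drain B (pop B ⨟ switch A λ { nothing → push TMP 𝟙 ; (just _) → pop A })

  subtracting : ∀ {o r q n vs} i j k →
    subtract ⊢ ⟨ o , r , q , n , unary k , unary i , unary j , vs ⟩
      ⟶[ rounds 3 j ] ⟨ o , r , q , n , unary ((j ∸ i) + k) , unary (i ∸ j) , [] , vs ⟩
  subtracting zero    zero    k = stopping refl
  subtracting (suc i) zero    k = stopping refl
  subtracting {o} {r} {q} {n} {vs} zero (suc j) k = looping refl (popping ⨾ switching pushing)
    (to (cong₂ ⟨ o , r , q , n ,_,_, [] , vs ⟩ (cong unary (+-suc j k)) (cong unary (0∸n≡0 j))) (subtracting zero j (suc k)))
  subtracting (suc i) (suc j) k = looping refl (popping ⨾ switching popping) (subtracting i j k)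

  wipe : Prog
  wipe = drain A (pop A) ⨟ drain TMP (pop TMP)

  wiping : ∀ {o r q n b vs} i k →
    wipe ⊢ ⟨ o , r , q , n , unary k , unary i , b , vs ⟩
      ⟶[ rounds 1 i + rounds 1 k ] ⟨ o , r , q , n , [] , [] , b , vs ⟩
  wiping {o} {r} {q} {n} {b} {vs} i k = wipeA i ⨾ wipeTMP k
    where
    wipeA : ∀ {t} i → drain A (pop A) ⊢ ⟨ o , r , q , n , t , unary i , b , vs ⟩
                        ⟶[ rounds 1 i ] ⟨ o , r , q , n , t , [] , b , vs ⟩
    wipeA zero    = stopping refl
    wipeA (suc i) = looping refl popping (wipeA i)
    wipeTMP : ∀ {a} k → drain TMP (pop TMP) ⊢ ⟨ o , r , q , n , unary k , a , b , vs ⟩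
                          ⟶[ rounds 1 k ] ⟨ o , r , q , n , [] , a , b , vs ⟩
    wipeTMP zero    = stopping refl
    wipeTMP (suc k) = looping refl popping (wipeTMP k)

  if-cleared : Prog → Prog → Prog
  if-cleared p p′ = switch TMP λ { nothing  → switch A λ { nothing → p ; (just _) → wipe ⨟ p′ }
                                 ; (just _) → wipe ⨟ p′ }

  test-eq : Fin K → Fin K → Prog → Prog → Prog
  test-eq x y p p′ = copy-var x A ⨟ copy-var y B ⨟ subtract ⨟ if-cleared p p′

  eq-cost : ℕ → ℕ
  eq-cost l = copy-cost l + (copy-cost l + (rounds 3 l + (2 + (rounds 1 l + rounds 1 l))))

  testing-eq : ∀ {o r q n vs τ c l} {x y i j p p′} → lookup vs x ≡ unary i → lookup vs y ≡ unary j →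
    i ≤ l → j ≤ l → (i≟j : Dec (i ≡ j)) →
    (if does i≟j then p else p′) ⊢ ⟨ o , r , q , n , [] , [] , [] , vs ⟩ ⟶[ c ] τ →
    test-eq x y p p′ ⊢ ⟨ o , r , q , n , [] , [] , [] , vs ⟩ ⟶[ eq-cost l + c ] τ
  testing-eq {o} {r} {q} {n} {vs} {τ} {c} {l} {i = i} {j} {p} {p′} ex ey i≤ j≤ i≟j run =
    within (≤-reflexive regroup)
      (within (copy-cost-mono i≤) (copying-A ex) ⨾ within (copy-cost-mono j≤) (copying-B ey) ⨾
       within (rounds-mono 3 j≤) (subtracting i j 0) ⨾ branch i≟j run)
    where
    e = rounds 1 l + rounds 1 l
    regroup : copy-cost l + (copy-cost l + (rounds 3 l + (2 + (e + c)))) ≡ eq-cost l + c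
    regroup = sym (trans (+-assoc (copy-cost l) _ c) (cong (copy-cost l +_)
                  (trans (+-assoc (copy-cost l) _ c) (cong (copy-cost l +_) (+-assoc (rounds 3 l) _ c)))))
    wiped : ∀ {i j p} → i ≤ l → j ≤ l → p ⊢ ⟨ o , r , q , n , [] , [] , [] , vs ⟩ ⟶[ c ] τ →
            wipe ⨟ p ⊢ ⟨ o , r , q , n , unary i , unary j , [] , vs ⟩ ⟶[ e + c ] τ
    wiped {i} {j} i≤ j≤ run = within (+-mono-≤ (rounds-mono 1 j≤) (rounds-mono 1 i≤)) (wiping j i) ⨾ run
    branch : (i≟j : Dec (i ≡ j)) → (if does i≟j then p else p′) ⊢ ⟨ o , r , q , n , [] , [] , [] , vs ⟩ ⟶[ c ] τ →
             if-cleared p p′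
               ⊢ ⟨ o , r , q , n , unary ((j ∸ i) + 0) , unary (i ∸ j) , [] , vs ⟩ ⟶[ 2 + (e + c) ] τ
    branch i≟j run with (j ∸ i) + 0 in ji | i ∸ j in ij | i≟j
    ... | zero  | zero  | yes _   = within (+-monoʳ-≤ 2 (m≤n+m c e)) (switching (switching run))
    ... | zero  | zero  | no i≢j  = contradiction
      (≤-antisym (m∸n≡0⇒m≤n ij) (m∸n≡0⇒m≤n (trans (sym (+-identityʳ _)) ji))) i≢j
    ... | zero  | suc k | yes refl = contradiction (trans (sym (n∸n≡0 i)) ij) λ ()
    ... | zero  | suc k | no _    = switching (switching (wiped {zero} z≤n (≤-trans (≤-reflexive (sym ij)) (≤-trans (m∸n≤m i j) i≤)) run))
    ... | suc k | _     | yes refl = contradiction (trans (sym (trans (+-identityʳ _) (n∸n≡0 i))) ji) λ ()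
    ... | suc k | h     | no _    = within (n≤1+n _) (switching (wiped
      (≤-trans (≤-reflexive (trans (sym ji) (+-identityʳ _))) (≤-trans (m∸n≤m j i) j≤))
      (≤-trans (≤-reflexive (sym ij)) (≤-trans (m∸n≤m i j) i≤)) run))

  copy-size : Fin K → Prog
  copy-size x = drain SIZE (pop SIZE ⨟ push TMP 𝟙 ⨟ push (var x) 𝟙) ⨟ drain TMP (pop TMP ⨟ push SIZE 𝟙)

  copying-size : ∀ {o r q a b vs} x k → lookup vs x ≡ [] →
    copy-size x ⊢ ⟨ o , r , q , unary k , [] , a , b , vs ⟩
      ⟶[ copy-cost k ] ⟨ o , r , q , unary k , [] , a , b , vs [ x ]≔ unary k ⟩
  copying-size {o} {r} {q} {a} {b} {vs} x k e =
    from (cong ⟨ o , r , q , unary k , [] , a , b ,_⟩ (trans (sym ([]≔-lookup vs x)) (cong (vs [ x ]≔_) e)))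
    (to (cong₂ (λ m v → ⟨ o , r , q , m , [] , a , b , vs [ x ]≔ v ⟩) (unary-ʳ++-[] k) (unary-ʳ++-[] k))
    (scan k ⨾ from (cong ⟨ o , r , q , [] ,_, a , b , vs [ x ]≔ (unary k ʳ++ []) ⟩ (unary-ʳ++-[] k)) (restore k)))
    where
    scan : ∀ k {t v} →
      drain SIZE (pop SIZE ⨟ push TMP 𝟙 ⨟ push (var x) 𝟙) ⊢ ⟨ o , r , q , unary k , t , a , b , vs [ x ]≔ v ⟩
        ⟶[ rounds 3 k ] ⟨ o , r , q , [] , unary k ʳ++ t , a , b , vs [ x ]≔ (unary k ʳ++ v) ⟩
    scan zero    = stopping refl
    scan (suc k) = looping refl (popping ⨾ pushing ⨾ push-var {vs = vs}) (scan k)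
    restore : ∀ k {m vs} →
      drain TMP (pop TMP ⨟ push SIZE 𝟙) ⊢ ⟨ o , r , q , m , unary k , a , b , vs ⟩
        ⟶[ rounds 2 k ] ⟨ o , r , q , unary k ʳ++ m , [] , a , b , vs ⟩
    restore zero    = stopping refl
    restore (suc k) = looping refl (popping ⨾ pushing) (restore k)

  -- The loop variable runs downwards and the output stack grows from its
  -- end, so the printed words appear in ascending order.
  counting-down : ∀ {r q n b vs x p c} j (g : Fin j → Word) →
    (∀ i o → p ⊢ ⟨ o , r , q , n , [] , [] , b , vs [ x ]≔ unary (toℕ i) ⟩
               ⟶[ c ] ⟨ g i ++ o , r , q , n , [] , [] , b , vs [ x ]≔ unary (toℕ i) ⟩) →
    ∀ o → drain (var x) (pop (var x) ⨟ p) ⊢ ⟨ o , r , q , n , [] , [] , b , vs [ x ]≔ unary j ⟩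
      ⟶[ rounds (1 + c) j ] ⟨ concat (tabulate g) ++ o , r , q , n , [] , [] , b , vs [ x ]≔ [] ⟩
  counting-down {vs = vs} {x} zero g body o = stopping (top-var vs x [])
  counting-down {r} {q} {n} {b} {vs} {x} {p} {c} (suc j) g body o =
    looping (top-var vs x (unary (suc j)))
      (pop-var {vs = vs} ⨾
       subst (λ h → p ⊢ ⟨ o , r , q , n , [] , [] , b , vs [ x ]≔ unary h ⟩
                ⟶[ c ] ⟨ g (fromℕ j) ++ o , r , q , n , [] , [] , b , vs [ x ]≔ unary h ⟩) (toℕ-fromℕ j) (body (fromℕ j) o))
      (to (cong ⟨_, r , q , n , [] , [] , b , vs [ x ]≔ [] ⟩ (sym reorder))
      (counting-down j (g ∘ inject₁) (λ i o′ →
        subst (λ h → p ⊢ ⟨ o′ , r , q , n , [] , [] , b , vs [ x ]≔ unary h ⟩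
                ⟶[ c ] ⟨ g (inject₁ i) ++ o′ , r , q , n , [] , [] , b , vs [ x ]≔ unary h ⟩) (toℕ-inject₁ i) (body (inject₁ i) o′)) (g (fromℕ j) ++ o)))
    where
    split : ∀ j (g : Fin (suc j) → Word) → concat (tabulate g) ≡ concat (tabulate (g ∘ inject₁)) ++ g (fromℕ j)
    split zero    g = ++-identityʳ _
    split (suc j) g = trans (cong (g zero ++_) (split j (g ∘ suc))) (sym (++-assoc (g zero) _ _))
    reorder : concat (tabulate g) ++ o ≡ concat (tabulate (g ∘ inject₁)) ++ g (fromℕ j) ++ o
    reorder = trans (cong (_++ o) (split j g)) (++-assoc (concat (tabulate (g ∘ inject₁))) _ _)

  -- At level k, every loop variable from k on holds 0.
  data Printer : ℕ → Set where
    out    : Word → Printer k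
    _∙_    : Printer k → Printer k → Printer k
    for    : (x : Fin K) → k ≤ toℕ x → Printer (suc (toℕ x)) → Printer k
    if-eq  : Fin K → Fin K → Printer k → Printer k → Printer k
    if-bit : Fin K → Fin K → Printer k → Printer k → Printer k
    copy   : Section → Fin K → Fin K → Printer k

  infixr 5 _∙_

  module _ {n : ℕ} (bits : Fin n → Fin n → Bool) (entries : Section → Fin n → Fin n → Word) where

    ⟦_⟧ : Printer k → Vec (Fin n) K → Word
    ⟦ out w ⟧         ρ = w
    ⟦ P ∙ Q ⟧         ρ = ⟦ P ⟧ ρ ++ ⟦ Q ⟧ ρ
    ⟦ for x _ P ⟧     ρ = concat (tabulate λ i → ⟦ P ⟧ (ρ [ x ]≔ i))
    ⟦ if-eq x y P Q ⟧ ρ = if does (lookup ρ x ≟ lookup ρ y) then ⟦ P ⟧ ρ else ⟦ Q ⟧ ρ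
    ⟦ if-bit x y P Q ⟧ ρ = if bits (lookup ρ x) (lookup ρ y) then ⟦ P ⟧ ρ else ⟦ Q ⟧ ρ
    ⟦ copy m x y ⟧    ρ = entries m (lookup ρ x) (lookup ρ y)

  write : Word → Prog
  write []      = skip
  write (c ∷ w) = write w ⨟ push OUT c

  -- In a concatenation the second part runs first, because the output stack grows from its end.
  compile : Printer k → Prog
  compile (out w)          = write w
  compile (P ∙ Q)          = compile Q ⨟ compile P
  compile (for x _ P)      = copy-size x ⨟ drain (var x) (pop (var x) ⨟ compile P)
  compile (if-eq x y P Q)  = test-eq x y (compile P) (compile Q)
  compile (if-bit x y P Q) = test-bit x y (compile P) (compile Q)
  compile (copy m x y)     = print m x y

  -- A conditional is charged for both branches, which keeps the bound a sum of polynomials.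
  cost : Printer k → ℕ → ℕ
  cost (out w)          l = suc (length w)
  cost (P ∙ Q)          l = cost Q l + cost P l
  cost (for x _ P)      l = copy-cost l + rounds (1 + cost P l) l
  cost (if-eq x y P Q)  l = eq-cost l + (cost P l + cost Q l)
  cost (if-bit x y P Q) l = seek-cost l + (1 + (rounds 3 l + (cost P l + cost Q l)))
  cost (copy m x y)     l = print-cost l

  writing : ∀ {r q n t a b vs} w o →
    write w ⊢ ⟨ o , r , q , n , t , a , b , vs ⟩ ⟶[ suc (length w) ] ⟨ w ++ o , r , q , n , t , a , b , vs ⟩
  writing []      o = skipping
  writing (c ∷ w) o = within (≤-reflexive (+-comm (suc (length w)) 1)) (writing w o ⨾ pushing)

  poly-rounds-id : ∀ c → Poly (rounds c)
  poly-rounds-id c = poly-rounds (poly-const c) poly-id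

  poly-copy : Poly copy-cost
  poly-copy = poly-+ (poly-rounds-id 3) (poly-rounds-id 2)

  poly-skip : Poly skip-cost
  poly-skip = poly-+ (poly-rounds-id 3) (poly-const 3)

  poly-walk : Poly walk-cost
  poly-walk = poly-rounds (poly-+ (poly-const 1) poly-skip) poly-id

  poly-seek : Poly seek-cost
  poly-seek = poly-+ poly-skip (poly-+ poly-copy (poly-+ poly-walk (poly-+ poly-copy poly-walk)))

  poly-cost : (P : Printer k) → Poly (cost P)
  poly-cost (out w)          = poly-const (suc (length w))
  poly-cost (P ∙ Q)          = poly-+ (poly-cost Q) (poly-cost P)
  poly-cost (for x _ P)      = poly-+ poly-copy (poly-rounds (poly-+ (poly-const 1) (poly-cost P)) poly-id)
  poly-cost (if-eq x y P Q)  = poly-+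
    (poly-+ poly-copy (poly-+ poly-copy (poly-+ (poly-rounds-id 3) (poly-+ (poly-const 2) (poly-+ (poly-rounds-id 1) (poly-rounds-id 1))))))
    (poly-+ (poly-cost P) (poly-cost Q))
  poly-cost (if-bit x y P Q) =
    poly-+ poly-seek (poly-+ (poly-const 1) (poly-+ (poly-rounds-id 3) (poly-+ (poly-cost P) (poly-cost Q))))
  poly-cost (copy m x y)     =
    poly-+ poly-seek (poly-+ (poly-rounds-id 4) (poly-+ (poly-rounds-id 3) (poly-rounds-id 3)))

  module Correctness {n : ℕ} (bits : Fin n → Fin n → Bool) (entries : Section → Fin n → Fin n → Word)
    (w : Word) (n≤w : n ≤ length w)
    (reads-bit   : ∀ i j → is-one (List.head (sought first (toℕ i) (toℕ j) w)) ≡ bits i j)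
    (reads-entry : ∀ m i j → upTo comma? (sought m (toℕ i) (toℕ j) w) ≡ entries m i j)
    (z : Fin n) (z≡0 : toℕ z ≡ 0)
    where

    vars : Vec (Fin n) K → Vec Word K
    vars = Vec.map (unary ∘ toℕ)

    state : Word → Vec (Fin n) K → Store (7 + K)
    state o ρ = ⟨ o , w , [] , unary n , [] , [] , [] , vars ρ ⟩

    private
      L = length w

      i≤ : (i : Fin n) → toℕ i ≤ L
      i≤ i = ≤-trans (<⇒≤ (toℕ<n i)) n≤w

      value : ∀ ρ x → lookup (vars ρ) x ≡ unary (toℕ (lookup ρ x))
      value ρ x = lookup-map x (unary ∘ toℕ) ρ

    -- The environment is total, so a variable not in use is given the vertex numbered 0. Its unary
    -- word is empty, which is what a loop expects on entry and leaves behind on exit.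
    correct : (P : Printer k) (ρ : Vec (Fin n) K) → (∀ y → k ≤ toℕ y → lookup ρ y ≡ z) → ∀ o →
      compile P ⊢ state o ρ ⟶[ cost P L ] state (⟦_⟧ bits entries P ρ ++ o) ρ
    correct (out v)    ρ fresh o = writing v o
    correct (P ∙ Q)    ρ fresh o = to (cong (λ o′ → state o′ ρ) (sym (++-assoc (⟦_⟧ bits entries P ρ) _ o)))
      (correct Q ρ fresh o ⨾ correct P ρ fresh _)
    correct (for x k≤x P) ρ fresh o =
      to (cong (λ v → ⟨ ⟦_⟧ bits entries (for x k≤x P) ρ ++ o , w , [] , unary n , [] , [] , [] , v ⟩) cleared)
      (within (copy-cost-mono n≤w) (copying-size x n empty) ⨾
       within (rounds-mono (1 + cost P L) n≤w) (counting-down n _ body o))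
      where
      empty : lookup (vars ρ) x ≡ []
      empty = trans (value ρ x) (trans (cong (unary ∘ toℕ) (fresh x k≤x)) (cong unary z≡0))
      cleared : vars ρ [ x ]≔ [] ≡ vars ρ
      cleared = trans (cong (vars ρ [ x ]≔_) (sym empty)) ([]≔-lookup (vars ρ) x)
      body : ∀ i o → compile P ⊢ ⟨ o , w , [] , unary n , [] , [] , [] , vars ρ [ x ]≔ unary (toℕ i) ⟩
               ⟶[ cost P L ] ⟨ ⟦_⟧ bits entries P (ρ [ x ]≔ i) ++ o , w , [] , unary n , [] , [] , [] , vars ρ [ x ]≔ unary (toℕ i) ⟩
      body i o = subst (λ v → compile P ⊢ ⟨ o , w , [] , unary n , [] , [] , [] , v ⟩
               ⟶[ cost P L ] ⟨ ⟦_⟧ bits entries P (ρ [ x ]≔ i) ++ o , w , [] , unary n , [] , [] , [] , v ⟩)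
        (map-[]≔ (unary ∘ toℕ) ρ x)
        -- Variables beyond `x` differ from `x`, so binding `x` leaves them fresh for the body.
        (correct P (ρ [ x ]≔ i) (λ y x<y → trans (lookup∘update′ (λ y≡x → <⇒≢ x<y (cong toℕ (sym y≡x))) ρ i) (fresh y (≤-trans k≤x (<⇒≤ x<y)))) o)
    correct (if-eq x y P Q) ρ fresh o = testing-eq (value ρ x) (value ρ y) (i≤ _) (i≤ _)
      -- The machine compares numbers, the semantics compares vertices. `map′` keeps the Boolean, so
      -- both take the same branch.
      (map′ (cong toℕ) toℕ-injective (lookup ρ x ≟ lookup ρ y)) branch
      where
      branch : (if does (lookup ρ x ≟ lookup ρ y) then compile P else compile Q) ⊢ state o ρ
                 ⟶[ cost P L + cost Q L ] state ((if does (lookup ρ x ≟ lookup ρ y) then ⟦_⟧ bits entries P ρ else ⟦_⟧ bits entries Q ρ) ++ o) ρ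
      branch with does (lookup ρ x ≟ lookup ρ y)
      ... | true  = within (m≤m+n _ _) (correct P ρ fresh o)
      ... | false = within (m≤n+m _ _) (correct Q ρ fresh o)
    correct (if-bit x y P Q) ρ fresh o = testing-bit (value ρ x) (value ρ y) (i≤ _) (i≤ _) branch
      where
      branch : (if is-one (List.head (sought first (toℕ (lookup ρ x)) (toℕ (lookup ρ y)) w)) then compile P else compile Q) ⊢ state o ρ
                 ⟶[ cost P L + cost Q L ] state ((if bits (lookup ρ x) (lookup ρ y) then ⟦_⟧ bits entries P ρ else ⟦_⟧ bits entries Q ρ) ++ o) ρ
      branch rewrite reads-bit (lookup ρ x) (lookup ρ y) with bits (lookup ρ x) (lookup ρ y)
      ... | true  = within (m≤m+n _ _) (correct P ρ fresh o)
      ... | false = within (m≤n+m _ _) (correct Q ρ fresh o)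
    correct (copy m x y) ρ fresh o =
      to (cong (λ v → state (v ++ o) ρ) (reads-entry m _ _))
      (printing m (value ρ x) (value ρ y) (i≤ _) (i≤ _))

standard-bound : ∀ {f} → Poly f → Σ[ c ∈ ℕ ] Σ[ d ∈ ℕ ] (∀ n → f n ≤ c * n ^ d + c)
standard-bound {f} (c , d , bound) = c * 2 ^ d , d , λ n →
  subst (f n ≤_) (trans (*-distribˡ-+ c (2 ^ d * n ^ d) (2 ^ d)) (cong (_+ c * 2 ^ d) (sym (*-assoc c (2 ^ d) (n ^ d)))))
    (≤-trans (bound n) (*-monoʳ-≤ c (suc-^-≤ n d)))

-- The encoding as a sequence of delimited blocks

plain? : Symbol → Bool
plain? 𝟘 = true
plain? 𝟙 = true
plain? ∞ = true
plain? _ = false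

Plain : Word → Set
Plain = All (λ a → plain? a ≡ true)

module _ {A : Set} (enc : A → Word) where

  row : ∀ {n} → (Fin n → A) → Word
  row M = concat (tabulate λ v → enc (M v) ++ [ comma ])

  rows : ∀ {n} → (Fin n → Fin n → A) → Word
  rows M = concat (tabulate λ u → row (M u) ++ [ semicolon ])

  module _ (plain : ∀ a → Plain (enc a)) where

    enc-free : ∀ a → Free comma? (enc a)
    enc-free a = All.map (λ { {𝟘} _ → refl ; {𝟙} _ → refl ; {∞} _ → refl ; {comma} () }) (plain a)

    row-free : ∀ {n} (M : Fin n → A) → Free semicolon? (row M)
    row-free M = Allₚ.concat⁺ (Allₚ.tabulate⁺ λ v →
      Allₚ.++⁺ (All.map (λ { {𝟘} _ → refl ; {𝟙} _ → refl ; {∞} _ → refl ; {semicolon} () }) (plain (M v))) (refl ∷ []))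

    rows-free : ∀ {n} (M : Fin n → Fin n → A) → Free bar? (rows M)
    rows-free M = Allₚ.concat⁺ (Allₚ.tabulate⁺ λ u → Allₚ.++⁺ (Allₚ.concat⁺ (Allₚ.tabulate⁺ λ v →
      Allₚ.++⁺ (All.map (λ { {𝟘} _ → refl ; {𝟙} _ → refl ; {∞} _ → refl ; {bar} () }) (plain (M u v))) (refl ∷ []))) (refl ∷ []))

    -- Rows contain no semicolon before their end and entries no comma, so counting separators leads
    -- to the wanted entry.
    afters-rows : ∀ {n} (M : Fin n → Fin n → A) i j r →
      ∃[ r′ ] afters comma? (toℕ j) (afters semicolon? (toℕ i) (rows M ++ r)) ≡ enc (M i j) ++ comma ∷ r′
    afters-rows M i j r
      with r₁ , e₁ ← afters-blocks semicolon? {semicolon} refl (row ∘ M) (row-free ∘ M) i r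
      with r₂ , e₂ ← afters-blocks comma? {comma} refl (enc ∘ M i) (enc-free ∘ M i) j (semicolon ∷ r₁)
      = r₂ , trans (cong (afters comma? (toℕ j)) e₁) e₂

-- Every block contributes at least its terminator. This bounds the number of vertices, and with it
-- every loop, by the length of the input.
blocks-length : ∀ {n c} (g : Fin n → Word) → n ≤ length (concat (tabulate λ u → g u ++ [ c ]))
blocks-length {zero}      g = z≤n
blocks-length {suc n} {c} g
  rewrite length-++ (g zero ++ [ c ]) {concat (tabulate λ u → g (suc u) ++ [ c ])} | length-++ (g zero) {[ c ]}
  = +-mono-≤ (m≤n+m 1 (length (g zero))) (blocks-length (g ∘ suc))

-- The semicolons of the adjacency matrix count the vertices. The accumulator mirrors the stack
-- `SIZE`.
tally : Word → ℕ → ℕ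
tally []      m = m
tally (a ∷ r) m = tally r (if semicolon? a then suc m else m)

tally-free : ∀ {p} → Free semicolon? p → ∀ {r} m → tally (p ++ r) m ≡ tally r m
tally-free []       m = refl
tally-free (f ∷ fs) m rewrite f = tally-free fs m

tally-blocks : ∀ {n} (g : Fin n → Word) → (∀ u → Free semicolon? (g u)) → ∀ m →
  tally (concat (tabulate λ u → g u ++ [ semicolon ])) m ≡ n + m
tally-blocks {zero}  g free m = refl
tally-blocks {suc n} g free m
  rewrite ++-assoc (g zero) [ semicolon ] (concat (tabulate λ u → g (suc u) ++ [ semicolon ]))
        | tally-free (free zero) {semicolon ∷ concat (tabulate λ u → g (suc u) ++ [ semicolon ])} m
  = trans (tally-blocks (g ∘ suc) (free ∘ suc) (suc m)) (+-suc n m)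

plain-bit : ∀ b → Plain (bit b)
plain-bit true  = refl ∷ []
plain-bit false = refl ∷ []

plain-entry : ∀ d → Plain (entry d)
plain-entry ⊤⁺      = refl ∷ []
plain-entry (fin m) = Allₚ.map⁺ (All.universal (λ { zero → refl ; (suc _) → refl }) _)

-- Loading the input and running a printer on it

module EncodedInput (K : ℕ) where
  open Machine K

  count : Prog
  count = while IN (until bar?) (switch IN λ
    { nothing → skip ; (just a) → pop IN ⨟ push PASSED a ⨟ (if semicolon? a then push SIZE 𝟙 else skip) })

  counting : ∀ {o t a b vs} r q m →
    count ⊢ ⟨ o , r , q , unary m , t , a , b , vs ⟩
      ⟶[ rounds 4 (length r) ] ⟨ o , from-first bar? r , upTo bar? r ʳ++ q , unary (tally (upTo bar? r) m) , t , a , b , vs ⟩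
  counting []      q m = stopping refl
  counting {o} {t} {a} {b} {vs} (c ∷ r) q m with bar? c in e
  ... | true  = within (s≤s z≤n) (stopping (cong not e))
  ... | false = looping (cong not e) (switching (popping ⨾ pushing ⨾ bump (semicolon? c))) (counting r (c ∷ q) _)
    where
    bump : ∀ β → (if β then push SIZE 𝟙 else skip) ⊢ ⟨ o , r , c ∷ q , unary m , t , a , b , vs ⟩
                   ⟶[ 1 ] ⟨ o , r , c ∷ q , unary (if β then suc m else m) , t , a , b , vs ⟩
    bump true  = pushing
    bump false = skipping

  -- The input arrives on the stack that must later hold the output. Two transfers, through `PASSED`
  -- to `IN`, preserve its order.
  load : Prog
  load = drain OUT (move OUT PASSED) ⨟ rewind ⨟ count ⨟ rewind

  unloading : ∀ {r n t a b vs} o q →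
    drain OUT (move OUT PASSED) ⊢ ⟨ o , r , q , n , t , a , b , vs ⟩ ⟶[ rounds 3 (length o) ] ⟨ [] , r , o ʳ++ q , n , t , a , b , vs ⟩
  unloading []      q = stopping refl
  unloading (c ∷ o) q = looping refl (switching (popping ⨾ pushing)) (unloading o (c ∷ q))

  load-cost : ℕ → ℕ
  load-cost l = rounds 3 l + (rounds 3 l + (rounds 4 l + rounds 3 l))

  loading : ∀ w {vs} →
    load ⊢ ⟨ w , [] , [] , [] , [] , [] , [] , vs ⟩
      ⟶[ load-cost (length w) ] ⟨ [] , w , [] , unary (tally (upTo bar? w) 0) , [] , [] , [] , vs ⟩
  loading w {vs} =
    unloading w [] ⨾
    within (rounds-mono 3 (≤-reflexive (trans (length-ʳ++ w) (+-identityʳ _))))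
      (to (cong (λ r → ⟨ [] , r , [] , [] , [] , [] , [] , vs ⟩) (trans (ʳ++-ʳ++ w) (++-identityʳ w))) (rewinding [] (w ʳ++ []))) ⨾
    counting w [] 0 ⨾
    within (rounds-mono 3 (behind≤ {w} {from-first bar? w} {u ʳ++ []} e))
      (to (cong (λ r → ⟨ [] , r , [] , unary (tally u 0) , [] , [] , [] , vs ⟩) e) (rewinding (from-first bar? w) (u ʳ++ [])))
    where
    u = upTo bar? w
    e : (u ʳ++ []) ʳ++ from-first bar? w ≡ w
    e = upTo-from-first bar? w []

  entries-of : ∀ {k} (I : Instance k) → Section → Fin (Instance.n I) → Fin (Instance.n I) → Word
  entries-of I first  i j = bit (Graph.adj (Instance.G I) i j)
  entries-of I second i j = entry (Instance.D I i j)

  meaning : ∀ {k l} (I : Instance k) → Printer l → Vec (Fin (Instance.n I)) K → Word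
  meaning I = ⟦_⟧ (Graph.adj (Instance.G I)) (entries-of I)

  module _ {k} (I : Instance k) where
    open Instance I

    private
      adj = Graph.adj G
      w = encode I
      w≡ : w ≡ rows bit adj ++ bar ∷ (rows entry D ++ [ bar ])
      w≡ = ++-assoc (rows bit adj) [ bar ] _

    after-section : ∀ m i j → ∃[ r ] sought m (toℕ i) (toℕ j) w ≡ entries-of I m i j ++ comma ∷ r
    after-section first i j rewrite w≡ = afters-rows bit plain-bit adj i j _
    after-section second i j rewrite w≡ | after-++ bar? (rows-free bit plain-bit adj) {bar} {rows entry D ++ [ bar ]} refl
      = afters-rows entry plain-entry D i j _

    reads-entry : ∀ m i j → upTo comma? (sought m (toℕ i) (toℕ j) w) ≡ entries-of I m i j
    reads-entry m i j with r , e ← after-section m i j rewrite e = upTo-++ comma? (free m) refl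
      where
      free : ∀ m → Free comma? (entries-of I m i j)
      free first  = enc-free bit plain-bit (adj i j)
      free second = enc-free entry plain-entry (D i j)

    reads-bit : ∀ i j → is-one (List.head (sought first (toℕ i) (toℕ j) w)) ≡ adj i j
    reads-bit i j with r , e ← after-section first i j rewrite e with adj i j
    ... | true  = refl
    ... | false = refl

    n≤size : n ≤ length w
    n≤size rewrite w≡ | length-++ (rows bit adj) {bar ∷ (rows entry D ++ [ bar ])}
      = ≤-trans (blocks-length (row bit ∘ adj)) (m≤m+n _ _)

    counted : tally (upTo bar? w) 0 ≡ n
    counted rewrite w≡ | upTo-++ bar? (rows-free bit plain-bit adj) {bar} {rows entry D ++ [ bar ]} refl
      = trans (tally-blocks (row bit ∘ adj) (row-free bit plain-bit ∘ adj) 0) (+-identityʳ n)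

    prints : (P : Printer 0) (z : Fin n) → toℕ z ≡ 0 →
      Σ[ t ∈ ℕ ] Computes (load ⨟ compile P) w t (meaning I P (replicate K z)) × t ≤ load-cost (length w) + cost P (length w)
    prints P z z≡0 =
      let t , run , t≤ = loading w ⨾ from start (correct P (replicate K z) (λ y _ → lookup-replicate y z) [])
      in t , (_ , run , ++-identityʳ _) , t≤
      where
      open Correctness adj (entries-of I) w n≤size reads-bit reads-entry z z≡0
      start : ⟨ [] , w , [] , unary (tally (upTo bar? w) 0) , [] , [] , [] , replicate K [] ⟩ ≡ state [] (replicate K z)
      start = cong₂ (λ m v → ⟨ [] , w , [] , unary m , [] , [] , [] , v ⟩) counted
        (trans (cong (replicate K) (cong unary (sym z≡0))) (sym (map-replicate (unary ∘ toℕ) z K)))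

  first-vertex : ∀ {k} (I : Instance k) → Σ[ z ∈ Fin (Instance.n I) ] toℕ z ≡ 0
  first-vertex I with Instance.n I | IsTree.nonempty (Instance.isTree I)
  ... | suc _ | _ = zero , refl

  total-cost : Printer 0 → ℕ → ℕ
  total-cost P l = load-cost l + cost P l

  poly-total : (P : Printer 0) → Poly (total-cost P)
  poly-total P = poly-+ (poly-+ (poly-rounds-id 3) (poly-+ (poly-rounds-id 3) (poly-+ (poly-rounds-id 4) (poly-rounds-id 3)))) (poly-cost P)

  printer-polynomial : ∀ {Δ k} (f : Instance k → Instance k) (P : Printer 0) →
    (∀ I ρ → meaning I P ρ ≡ encode (f I)) → PolynomialTime (TTR Δ k) (DiTTR Δ k) f
  -- `6 + K` further stacks besides stack 0, which is `OUT`.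
  printer-polynomial {k = k} f P means = 6 + K , load ⨟ compile P , proj₁ b , proj₁ (proj₂ b) , run
    where
    b = standard-bound (poly-total P)
    run : (I : Instance k) → Σ[ t ∈ ℕ ] Computes (load ⨟ compile P) (encode I) t (encode (f I)) ×
                             t ≤ proj₁ b * length (encode I) ^ proj₁ (proj₂ b) + proj₁ b
    run I = halt (prints I P (proj₁ (first-vertex I)) (proj₂ (first-vertex I)))
      where
      halt : (Σ[ t ∈ ℕ ] Computes (load ⨟ compile P) (encode I) t (meaning I P (replicate K (proj₁ (first-vertex I)))) ×
               t ≤ total-cost P (length (encode I))) → _
      halt (t , (τ , r , e) , t≤) = t , (τ , r , trans e (means I _)) , ≤-trans t≤ (proj₂ (proj₂ b) (length (encode I)))

-- The printer of the glued instance

module _ {A : Set} where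

  concat-++ : ∀ a {b} (f : Fin (a + b) → List A) →
    concat (tabulate f) ≡ concat (tabulate (λ i → f (i ↑ˡ b))) ++ concat (tabulate (λ j → f (a ↑ʳ j)))
  concat-++ zero    f = refl
  concat-++ (suc a) f = trans (cong (f zero ++_) (concat-++ a (f ∘ suc))) (sym (++-assoc (f zero) _ _))

  concat-combine : ∀ a b (f : Fin (a * b) → List A) →
    concat (tabulate f) ≡ concat (tabulate λ i → concat (tabulate λ j → f (combine {a} {b} i j)))
  concat-combine zero    b f = refl
  concat-combine (suc a) b f = trans (concat-++ b f) (cong (concat (tabulate (λ j → f (j ↑ˡ (a * b)))) ++_) (concat-combine a b (λ j → f (b ↑ʳ j))))

concat-cong : ∀ {A : Set} {n} {f g : Fin n → List A} → (∀ i → f i ≡ g i) → concat (tabulate f) ≡ concat (tabulate g)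
concat-cong f≗g = cong concat (tabulate-cong f≗g)

-- The reason for the lexicographic numbering: a pass over all vertices of the glued tree is a loop
-- over `u` and `v` with `m` fixed items inside.
concat-vertex : ∀ {A : Set} {n m} (g : Vertex n m → List A) → concat (tabulate (g ∘ vertex {n} {m})) ≡
  concat (tabulate λ u → g (base u) ++ concat (tabulate λ v → concat (tabulate λ x → g (new u v x))))
concat-vertex {n = n} {m} g = trans (concat-combine n (suc (n * m)) (g ∘ vertex)) (concat-cong λ u →
  cong₂ _++_ (cong g (vertex-number (base u)))
    (trans (concat-combine n m _) (concat-cong λ v → concat-cong λ x → cong g (vertex-number (new u v x)))))

module Printing {Δ k : ℕ} (Ĝ : Gadget Δ k) where
  open Attaching Ĝ
  open Gadget Ĝ using (v₁; v₂) renaming (n to m)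
  open Machine 4
  open EncodedInput 4

  -- A vertex known at compile time up to its variables: the gadget vertex is fixed, the tree
  -- vertices are loop variables. Variables 0 and 1 describe the row, 2 and 3 the column.
  Name : Set
  Name = Vertex 4 m

  module _ {l : ℕ} where

    -- The gadget is constant, so the pass over its vertices is unrolled in the program and needs no
    -- variable.
    sequence : ∀ {m} → (Fin m → Printer l) → Printer l
    sequence {zero}  P = out []
    sequence {suc m} P = P zero ∙ sequence (P ∘ suc)

    print-joined : Link → (w u v : Fin 4) → Printer l
    print-joined side₁ w u v = if-eq w u (out (bit true)) (out (bit false))
    print-joined side₂ w u v = if-eq w v (out (bit true)) (out (bit false))
    print-joined far   w u v = out (bit false)

    print-adj : Name → Name → Printer l
    print-adj (base a)    (base b)      = copy first a b
    print-adj (base w)    (new u v y)   = print-joined (link y) w u v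
    print-adj (new u v x) (base w)      = print-joined (link x) w u v
    print-adj (new u v x) (new u′ v′ y) =
      if-eq u u′ (if-eq v v′ (out (bit (inner x y))) (out (bit false))) (out (bit false))

    -- In continuation style: which gadget vertex results is decided only by comparisons at run
    -- time, but it is a constant in each branch, so the entry to be printed can be looked up
    -- beforehand.
    with-origin : (u v : Fin 4) → Name → (Maybe (Fin m) → Printer l) → Printer l
    with-origin u v (base w)      κ = if-eq w u (κ (just v₁)) (if-eq w v (κ (just v₂)) (κ nothing))
    with-origin u v (new u′ v′ x) κ =
      if-eq u′ u (if-eq v′ v (κ (if core x then nothing else just x)) (κ nothing)) (κ nothing)

    print-copied : (u v : Fin 4) → Name → Name → Printer l
    print-copied u v r s = if-bit u v
      (with-origin u v r λ x → with-origin u v s λ y → out (entry (entryH {4} x y)))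
      (out (entry ⊤⁺))

    print-bound : Name → Name → Printer l
    print-bound (base a)      (base b)      = copy second a b
    print-bound r@(base _)    s@(new u v _) = print-copied u v r s
    print-bound r@(new u v _) s             = print-copied u v r s

  Cells : Set
  Cells = ∀ {l} → Name → Name → Printer l

  -- A row is printed at level 1 for a base vertex and at level 2 for a new one, hence a bound on
  -- the level instead of a fixed one.
  print-row : Cells → ∀ {l} → l ≤ 2 → Name → Printer l
  print-row cell l≤2 r =
    for (suc (suc zero)) l≤2
      (cell r (base (suc (suc zero))) ∙ out [ comma ] ∙
       for (suc (suc (suc zero))) ≤-refl
         (sequence λ x → cell r (new (suc (suc zero)) (suc (suc (suc zero))) x) ∙ out [ comma ]))
    ∙ out [ semicolon ]

  print-matrix : Cells → Printer 0
  print-matrix cell =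
    for zero z≤n
      (print-row cell (s≤s z≤n) (base zero) ∙
       for (suc zero) ≤-refl (sequence λ x → print-row cell ≤-refl (new zero (suc zero) x)))
    ∙ out [ bar ]

  print-reduced : Printer 0
  print-reduced = print-matrix print-adj ∙ print-matrix print-bound

  module _ (I : Instance k) where
    open Instance I
    open Correspondence Ĝ I using (reduced)

    private
      adj = Graph.adj G

    ⟪_⟫ : ∀ {l} → Printer l → Vec (Fin n) 4 → Word
    ⟪_⟫ = meaning I

    value : Vec (Fin n) 4 → Name → Vertex n m
    value ρ (base w)    = base (lookup ρ w)
    value ρ (new u v x) = new (lookup ρ u) (lookup ρ v) x

    sequence-meaning : ∀ {m l} (P : Fin m → Printer l) ρ → ⟪ sequence P ⟫ ρ ≡ concat (tabulate λ x → ⟪ P x ⟫ ρ)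
    sequence-meaning {zero}  P ρ = refl
    sequence-meaning {suc m} P ρ = cong (⟪ P zero ⟫ ρ ++_) (sequence-meaning (P ∘ suc) ρ)

    bit-if : ∀ b → (if b then bit true else bit false) ≡ bit b
    bit-if true  = refl
    bit-if false = refl

    joined-meaning : ∀ {l} k w u v ρ →
      ⟪ print-joined {l} k w u v ⟫ ρ ≡ bit (joined k (lookup ρ w) (lookup ρ u) (lookup ρ v))
    joined-meaning side₁ w u v ρ = bit-if (does (lookup ρ w ≟ lookup ρ u))
    joined-meaning side₂ w u v ρ = bit-if (does (lookup ρ w ≟ lookup ρ v))
    joined-meaning far   w u v ρ = refl

    adj-meaning : ∀ {l} r s ρ → ⟪ print-adj {l} r s ⟫ ρ ≡ bit (adjV adj (value ρ r) (value ρ s))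
    adj-meaning (base a)    (base b)      ρ = refl
    adj-meaning (base w)    (new u v y)   ρ = joined-meaning (link y) w u v ρ
    adj-meaning (new u v x) (base w)      ρ = joined-meaning (link x) w u v ρ
    adj-meaning (new u v x) (new u′ v′ y) ρ with does (lookup ρ u ≟ lookup ρ u′) | does (lookup ρ v ≟ lookup ρ v′)
    ... | false | _     = refl
    ... | true  | false = refl
    ... | true  | true  = refl

    origin-meaning : ∀ {l} u v r (κ : Maybe (Fin m) → Printer l) ρ →
      ⟪ with-origin u v r κ ⟫ ρ ≡ ⟪ κ (origin (lookup ρ u) (lookup ρ v) (value ρ r)) ⟫ ρ
    origin-meaning u v (base w) κ ρ with does (lookup ρ w ≟ lookup ρ u) | does (lookup ρ w ≟ lookup ρ v)
    ... | true  | _     = refl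
    ... | false | true  = refl
    ... | false | false = refl
    origin-meaning u v (new u′ v′ x) κ ρ with does (lookup ρ u′ ≟ lookup ρ u) | does (lookup ρ v′ ≟ lookup ρ v)
    ... | false | _     = refl
    ... | true  | false = refl
    ... | true  | true  = refl

    -- The printer works over its four variables and the instance over `n` vertices; the gadget
    -- entry is the same for both.
    entryH-irrelevant : ∀ x y → entryH {4} x y ≡ entryH {n} x y
    entryH-irrelevant nothing  _        = refl
    entryH-irrelevant (just _) nothing  = refl
    entryH-irrelevant (just _) (just _) = refl

    copied-meaning : ∀ {l} u v r s ρ →
      ⟪ print-copied {l} u v r s ⟫ ρ ≡ entry (copied adj D (lookup ρ u) (lookup ρ v) (value ρ r) (value ρ s))
    copied-meaning {l} u v r s ρ with adj (lookup ρ u) (lookup ρ v)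
    ... | false = refl
    ... | true  = trans (origin-meaning {l} u v r _ ρ) (trans (origin-meaning {l} u v s _ ρ)
      (cong entry (entryH-irrelevant (origin (lookup ρ u) (lookup ρ v) (value ρ r)) (origin (lookup ρ u) (lookup ρ v) (value ρ s)))))

    bound-meaning : ∀ {l} r s ρ → ⟪ print-bound {l} r s ⟫ ρ ≡ entry (boundV adj D (value ρ r) (value ρ s))
    bound-meaning (base a)     (base b)    ρ = refl
    bound-meaning {l} (base a) (new u v x) ρ = copied-meaning {l} u v (base a) (new u v x) ρ
    bound-meaning {l} (new u v x) s        ρ = copied-meaning {l} u v (new u v x) s ρ

    module _ {A : Set} (enc : A → Word) (M : Vertex n m → Vertex n m → A) (cell : Cells)
      (cell-meaning : ∀ {l} r s ρ → ⟪ cell {l} r s ⟫ ρ ≡ enc (M (value ρ r) (value ρ s))) where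

      row-word : Vertex n m → Word
      row-word r = concat (tabulate λ j → enc (M r (vertex j)) ++ [ comma ]) ++ [ semicolon ]

      -- The two hypotheses say that the row's name does not mention the column variables, so the
      -- inner loops leave its value alone.
      row-meaning : ∀ {l} (l≤2 : l ≤ 2) r ρ → (∀ i j → value (ρ [ suc (suc zero) ]≔ i [ suc (suc (suc zero)) ]≔ j) r ≡ value ρ r) →
        (∀ i → value (ρ [ suc (suc zero) ]≔ i) r ≡ value ρ r) →
        ⟪ print-row cell l≤2 r ⟫ ρ ≡ row-word (value ρ r)
      row-meaning l≤2 r ρ@(a ∷ b ∷ c ∷ d ∷ []) fixed₂ fixed₁ = cong (_++ [ semicolon ]) (trans
        (concat-cong λ i → trans (sym (++-assoc (⟪ cell {3} r (base (suc (suc zero))) ⟫ (a ∷ b ∷ i ∷ d ∷ [])) [ comma ] _)) (cong₂ _++_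
          (cong (_++ [ comma ]) (trans (cell-meaning r (base (suc (suc zero))) (a ∷ b ∷ i ∷ d ∷ [])) (cong (λ r′ → enc (M r′ (base i))) (fixed₁ i))))
          (concat-cong λ j → trans (sequence-meaning (λ x → cell r (new (suc (suc zero)) (suc (suc (suc zero))) x) ∙ out [ comma ]) (a ∷ b ∷ i ∷ j ∷ [])) (concat-cong λ x →
            cong (_++ [ comma ]) (trans (cell-meaning r (new (suc (suc zero)) (suc (suc (suc zero))) x) (a ∷ b ∷ i ∷ j ∷ []))
              (cong (λ r′ → enc (M r′ (new i j x))) (fixed₂ i j)))))))
        (sym (concat-vertex λ s → enc (M (value ρ r) s) ++ [ comma ])))

      matrix-meaning : ∀ ρ → ⟪ print-matrix cell ⟫ ρ ≡ matrix enc (λ i j → M (vertex i) (vertex j))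
      matrix-meaning (a ∷ b ∷ c ∷ d ∷ []) = cong (_++ [ bar ]) (trans
        (concat-cong λ u → cong₂ _++_
          (row-meaning (s≤s z≤n) (base zero) (u ∷ b ∷ c ∷ d ∷ []) (λ _ _ → refl) (λ _ → refl))
          (concat-cong λ v → trans (sequence-meaning (λ x → print-row cell ≤-refl (new zero (suc zero) x)) (u ∷ v ∷ c ∷ d ∷ [])) (concat-cong λ x →
            row-meaning ≤-refl (new zero (suc zero) x) (u ∷ v ∷ c ∷ d ∷ []) (λ _ _ → refl) (λ _ → refl))))
        (sym (concat-vertex row-word)))

    print-reduced-meaning : ∀ ρ → ⟪ print-reduced ⟫ ρ ≡ encode reduced
    print-reduced-meaning ρ = cong₂ _++_
      (matrix-meaning bit (adjV adj) print-adj adj-meaning ρ)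
      (matrix-meaning entry (boundV adj D) print-bound bound-meaning ρ)

lemma13 : (Δ k : ℕ) → 1 ≤ Δ →
    (c d : ℕ) (Ĝ : Gadget Δ k) → size (Gadget.inst Ĝ) ≤ c * (Δ + k) ^ d + c →
    TTR Δ k ≤ᵖ DiTTR Δ k
lemma13 Δ k 1≤Δ c d Ĝ _ =
  (λ I → reduced I) ,
  EncodedInput.printer-polynomial 4 {Δ} (λ I → reduced I) print-reduced print-reduced-meaning ,
  (λ I → equivalent I 1≤Δ)
  where
  open Correspondence Ĝ
  open Printing Ĝ
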